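{- Let $h$ and $d$ be integers with $h \geq 1$ and $d \geq 3$. Then there exists an integral convex polytope of dimension $d$ which is very ample, is not normal, and has exactly $h$ holes.
   Context: An integral convex polytope is a convex polytope $\mathcal{P} \subset \mathbb{R}^N$ all of whose vertices lie in $\mathbb{Z}^N$. Let $\widetilde{\mathcal{P}} \subset \mathbb{R}^{N+1}$ be the convex hull of the points $(\alpha,1)$ with $\alpha \in \mathcal{P}$, and let $\mathcal{A}_{\mathcal{P}} = \widetilde{\mathcal{P}} \cap \mathbb{Z}^{N+1}$. Write $\mathbb{R}_{\geq 0}\mathcal{A}_{\mathcal{P}}$, $\mathbb{Z}\mathcal{A}_{\mathcal{P}}$, $\mathbb{Z}_{\geq 0}\mathcal{A}_{\mathcal{P}}$ for the sets of all finite linear combinations of elements of $\mathcal{A}_{\mathcal{P}}$ with coefficients in $\mathbb{R}_{\ge 0}$, $\mathbb{Z}$, $\mathbb{Z}_{\ge 0}$, respectively. The polytope $\mathcal{P}$ is normal if $\mathbb{R}_{\geq 0}\mathcal{A}_{\mathcal{P}} \cap \mathbb{Z}\mathcal{A}_{\mathcal{P}} = \mathbb{Z}_{\geq 0}\mathcal{A}_{\mathcal{P}}$. It is very ample if the set $(\mathbb{R}_{\geq 0}\mathcal{A}_{\mathcal{P}} \cap \mathbb{Z}\mathcal{A}_{\mathcal{P}}) \setminus \mathbb{Z}_{\geq 0}\mathcal{A}_{\mathcal{P}}$ is finite; the elements of this set are called the holes of $\mathcal{P}$. -}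

module Defs where

open import Algebra.Bundles.Raw using (RawMonoid)
import Algebra.Definitions.RawMonoid as RawMonoidDefinitions
open import Data.Fin.Base using (Fin; fromℕ)
open import Data.Integer.Base using (ℤ; +_)
open import Data.Nat.Base as ℕ using (ℕ; suc)
import Data.Nat.Properties as ℕ
open import Data.Product.Base using (∃; ∃-syntax; Σ-syntax; _×_; _,_; proj₁)
open import Data.Rational.Base as ℚ using (ℚ; 0ℚ; 1ℚ; ½; ∣_∣)
import Data.Rational.Properties as ℚ
import Data.Rational.Solver as ℚ-Solver
open import Data.Vec.Functional using (Vector; insertAt)
import Data.Vec.Functional.Relation.Binary.Equality.Setoid as VectorEquality
open import Function.Base using (_∘_)
open import Function.Bundles using (Bijection)
open import Level using (0ℓ)
open import Relation.Binary.Bundles using (Setoid)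
import Relation.Binary.Construct.On as On
open import Relation.Binary.PropositionalEquality as ≡ using (_≡_; cong; subst; subst₂)
open import Relation.Unary using (Pred; _∈_; _⊆_; _≐_; _∩_; _∖_; U)

-- Real numbers are Cauchy sequences of rationals; _≈_ is their equality.

IsCauchy : (ℕ → ℚ) → Set
IsCauchy x = ∀ ε → 0ℚ ℚ.< ε →
  ∃[ N ] ∀ m n → N ℕ.≤ m → N ℕ.≤ n → ∣ x m ℚ.- x n ∣ ℚ.≤ ε

record ℝ : Set where
  constructor mkℝ
  field
    seq    : ℕ → ℚ
    cauchy : IsCauchy seq

open ℝ public

Eventually : Pred ℕ 0ℓ → Set
Eventually P = ∃[ N ] ∀ n → N ℕ.≤ n → P n

infix 4 _≈_ _≤_ _<_

_≈_ : ℝ → ℝ → Set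
x ≈ y = ∀ ε → 0ℚ ℚ.< ε → Eventually λ n → ∣ seq x n ℚ.- seq y n ∣ ℚ.≤ ε

_≤_ : ℝ → ℝ → Set
x ≤ y = ∀ ε → 0ℚ ℚ.< ε → Eventually λ n → seq x n ℚ.≤ seq y n ℚ.+ ε

_<_ : ℝ → ℝ → Set
x < y = Σ[ ε ∈ ℚ ] 0ℚ ℚ.< ε × Eventually λ n → seq x n ℚ.+ ε ℚ.≤ seq y n

private
  open ℚ-Solver.+-*-Solver using (solve; _:=_; _:+_; _:*_; :-_)

  half>0 : ∀ {ε} → 0ℚ ℚ.< ε → 0ℚ ℚ.< ½ ℚ.* ε
  half>0 = ℚ.*-monoʳ-<-pos ½

  half+half : ∀ ε → ½ ℚ.* ε ℚ.+ ½ ℚ.* ε ≡ ε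
  half+half ε = ≡.trans (≡.sym (ℚ.*-distribʳ-+ ε ½ ½)) (ℚ.*-identityˡ ε)

  ≤-half+half : ∀ {p q ε} → p ℚ.≤ ½ ℚ.* ε → q ℚ.≤ ½ ℚ.* ε → p ℚ.+ q ℚ.≤ ε
  ≤-half+half {ε = ε} p≤ q≤ = subst (_ ℚ.≤_) (half+half ε) (ℚ.+-mono-≤ p≤ q≤)

  ∣p-p∣≤ : ∀ p {ε} → 0ℚ ℚ.< ε → ∣ p ℚ.- p ∣ ℚ.≤ ε
  ∣p-p∣≤ p {ε} ε>0 = subst (λ q → ∣ q ∣ ℚ.≤ ε) (≡.sym (ℚ.+-inverseʳ p)) (ℚ.<⇒≤ ε>0)

  ∣p-q∣-sym : ∀ p q → ∣ p ℚ.- q ∣ ≡ ∣ q ℚ.- p ∣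
  ∣p-q∣-sym p q = ≡.trans (≡.sym (ℚ.∣-p∣≡∣p∣ (p ℚ.- q)))
    (cong ∣_∣ (solve 2 (λ p q → :- (p :+ :- q) := q :+ :- p) ≡.refl p q))

  ∣p-r∣≤ : ∀ p q r → ∣ p ℚ.- r ∣ ℚ.≤ ∣ p ℚ.- q ∣ ℚ.+ ∣ q ℚ.- r ∣
  ∣p-r∣≤ p q r = subst (λ s → ∣ s ∣ ℚ.≤ ∣ p ℚ.- q ∣ ℚ.+ ∣ q ℚ.- r ∣)
    (solve 3 (λ p q r → (p :+ :- q) :+ (q :+ :- r) := p :+ :- r) ≡.refl p q r)
    (ℚ.∣p+q∣≤∣p∣+∣q∣ (p ℚ.- q) (q ℚ.- r))

≈-setoid : Setoid 0ℓ 0ℓ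
≈-setoid = record
  { Carrier       = ℝ
  ; _≈_           = _≈_
  ; isEquivalence = record
    { refl  = λ {x} ε ε>0 → 0 , λ n _ → ∣p-p∣≤ (seq x n) ε>0
    ; sym   = λ {x} {y} x≈y ε ε>0 →
        let N , p = x≈y ε ε>0
        in  N , λ n N≤n → subst (ℚ._≤ ε) (∣p-q∣-sym (seq x n) (seq y n)) (p n N≤n)
    ; trans = λ {x} {y} {z} x≈y y≈z ε ε>0 →
        let M , p = x≈y (½ ℚ.* ε) (half>0 ε>0)
            N , q = y≈z (½ ℚ.* ε) (half>0 ε>0)
        in  M ℕ.⊔ N , λ n le →
              ℚ.≤-trans (∣p-r∣≤ (seq x n) (seq y n) (seq z n))
                (≤-half+half (p n (ℕ.m⊔n≤o⇒m≤o M N le)) (q n (ℕ.m⊔n≤o⇒n≤o M N le)))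
    }
  }

fromℚ : ℚ → ℝ
fromℚ p = mkℝ (λ _ → p) λ ε ε>0 → 0 , λ _ _ _ _ → ∣p-p∣≤ p ε>0

fromℤ : ℤ → ℝ
fromℤ z = fromℚ (z ℚ./ 1)

fromℕℝ : ℕ → ℝ
fromℕℝ n = fromℤ (+ n)

0ℝ 1ℝ : ℝ
0ℝ = fromℚ 0ℚ
1ℝ = fromℚ 1ℚ

infixl 6 _+_
infixl 7 _*_

_+_ : ℝ → ℝ → ℝ
x + y = mkℝ (λ n → seq x n ℚ.+ seq y n) λ ε ε>0 →
  let M , p = cauchy x (½ ℚ.* ε) (half>0 ε>0)
      N , q = cauchy y (½ ℚ.* ε) (half>0 ε>0)
  in  M ℕ.⊔ N , λ m n le le′ →
        ℚ.≤-trans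
          (subst (λ s → ∣ s ∣ ℚ.≤ ∣ seq x m ℚ.- seq x n ∣ ℚ.+ ∣ seq y m ℚ.- seq y n ∣)
            (solve 4 (λ a b c d → (a :+ :- b) :+ (c :+ :- d) := (a :+ c) :+ :- (b :+ d)) ≡.refl
              (seq x m) (seq x n) (seq y m) (seq y n))
            (ℚ.∣p+q∣≤∣p∣+∣q∣ (seq x m ℚ.- seq x n) (seq y m ℚ.- seq y n)))
          (≤-half+half
            (p m n (ℕ.m⊔n≤o⇒m≤o M N le) (ℕ.m⊔n≤o⇒m≤o M N le′))
            (q m n (ℕ.m⊔n≤o⇒n≤o M N le) (ℕ.m⊔n≤o⇒n≤o M N le′)))

private
  0<1 : 0ℚ ℚ.< 1ℚ
  0<1 = ℚ.positive⁻¹ 1ℚ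

  eventuallyBounded : ∀ x → Σ[ B ∈ ℚ ] 0ℚ ℚ.< B × Eventually λ n → ∣ seq x n ∣ ℚ.≤ B
  eventuallyBounded x =
    let N , p = cauchy x 1ℚ 0<1
        a     = seq x N
    in  1ℚ ℚ.+ ∣ a ∣ , ℚ.+-mono-<-≤ 0<1 (ℚ.0≤∣p∣ a) , N , λ n N≤n →
          ℚ.≤-trans
            (subst (λ s → ∣ s ∣ ℚ.≤ ∣ seq x n ℚ.- a ∣ ℚ.+ ∣ a ∣)
              (solve 2 (λ b a → (b :+ :- a) :+ a := b) ≡.refl (seq x n) a)
              (ℚ.∣p+q∣≤∣p∣+∣q∣ (seq x n ℚ.- a) a))
            (ℚ.+-monoˡ-≤ ∣ a ∣ (p n N N≤n ℕ.≤-refl))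

  -- For B > 0 and ε > 0, a δ > 0 with B · δ = ε.
  divide : ∀ {B ε} → 0ℚ ℚ.< B → 0ℚ ℚ.< ε → Σ[ δ ∈ ℚ ] 0ℚ ℚ.< δ × B ℚ.* δ ≡ ε
  divide {B} {ε} B>0 ε>0 = B⁻¹ ℚ.* ε , δ>0 , Bδ≡ε
    where
    instance
      B-pos : ℚ.Positive B
      B-pos = ℚ.positive B>0

      B-nonZero : ℚ.NonZero B
      B-nonZero = ℚ.pos⇒nonZero B

    B⁻¹ : ℚ
    B⁻¹ = ℚ.1/ B

    δ>0 : 0ℚ ℚ.< B⁻¹ ℚ.* ε
    δ>0 = subst (ℚ._< B⁻¹ ℚ.* ε) (ℚ.*-zeroʳ B⁻¹)
      (ℚ.*-monoʳ-<-pos B⁻¹ {{ℚ.1/pos⇒pos B}} ε>0)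

    Bδ≡ε : B ℚ.* (B⁻¹ ℚ.* ε) ≡ ε
    Bδ≡ε = ≡.trans (≡.sym (ℚ.*-assoc B B⁻¹ ε))
      (≡.trans (cong (ℚ._* ε) (ℚ.*-inverseʳ B)) (ℚ.*-identityˡ ε))

  *-bound : ∀ {p q B δ ε} → 0ℚ ℚ.< B → B ℚ.* δ ≡ ε →
            ∣ p ∣ ℚ.≤ B → ∣ q ∣ ℚ.≤ δ → ∣ p ℚ.* q ∣ ℚ.≤ ε
  *-bound {p} {q} {B} {δ} B>0 eq p≤ q≤ =
    subst₂ ℚ._≤_ (≡.sym (ℚ.∣p*q∣≡∣p∣*∣q∣ p q)) eq
      (ℚ.≤-trans
        (ℚ.*-monoʳ-≤-nonNeg ∣ q ∣ {{ℚ.nonNegative (ℚ.0≤∣p∣ q)}} p≤)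
        (ℚ.*-monoˡ-≤-nonNeg B {{ℚ.nonNegative (ℚ.<⇒≤ B>0)}} q≤))

_*_ : ℝ → ℝ → ℝ
x * y = mkℝ (λ n → seq x n ℚ.* seq y n) λ ε ε>0 →
  let A , A>0 , K , x≤A = eventuallyBounded x
      B , B>0 , L , y≤B = eventuallyBounded y
      α , α>0 , Aα≡     = divide A>0 (half>0 ε>0)
      β , β>0 , Bβ≡     = divide B>0 (half>0 ε>0)
      M , p             = cauchy x β β>0
      N , q             = cauchy y α α>0
      T                 = (K ℕ.⊔ L) ℕ.⊔ (M ℕ.⊔ N)
      K≤ : ∀ {n} → T ℕ.≤ n → K ℕ.≤ n
      K≤ le = ℕ.m⊔n≤o⇒m≤o K L (ℕ.m⊔n≤o⇒m≤o (K ℕ.⊔ L) (M ℕ.⊔ N) le)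
      L≤ : ∀ {n} → T ℕ.≤ n → L ℕ.≤ n
      L≤ le = ℕ.m⊔n≤o⇒n≤o K L (ℕ.m⊔n≤o⇒m≤o (K ℕ.⊔ L) (M ℕ.⊔ N) le)
      M≤ : ∀ {n} → T ℕ.≤ n → M ℕ.≤ n
      M≤ le = ℕ.m⊔n≤o⇒m≤o M N (ℕ.m⊔n≤o⇒n≤o (K ℕ.⊔ L) (M ℕ.⊔ N) le)
      N≤ : ∀ {n} → T ℕ.≤ n → N ℕ.≤ n
      N≤ le = ℕ.m⊔n≤o⇒n≤o M N (ℕ.m⊔n≤o⇒n≤o (K ℕ.⊔ L) (M ℕ.⊔ N) le)
  in  T , λ m n le le′ →
        let u = seq x m ℚ.* (seq y m ℚ.- seq y n)
            v = seq y n ℚ.* (seq x m ℚ.- seq x n)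
        in  ℚ.≤-trans
              (subst (λ s → ∣ s ∣ ℚ.≤ ∣ u ∣ ℚ.+ ∣ v ∣)
                (solve 4 (λ a b c d → a :* (c :+ :- d) :+ d :* (a :+ :- b) := a :* c :+ :- (b :* d)) ≡.refl
                  (seq x m) (seq x n) (seq y m) (seq y n))
                (ℚ.∣p+q∣≤∣p∣+∣q∣ u v))
              (≤-half+half
                (*-bound {seq x m} A>0 Aα≡ (x≤A m (K≤ le)) (q m n (N≤ le) (N≤ le′)))
                (*-bound {seq y n} B>0 Bβ≡ (y≤B n (L≤ le′)) (p m n (M≤ le) (M≤ le′))))

+-rawMonoid : RawMonoid 0ℓ 0ℓ
+-rawMonoid = record { Carrier = ℝ ; _≈_ = _≈_ ; _∙_ = _+_ ; ε = 0ℝ }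

open RawMonoidDefinitions +-rawMonoid public using (sum)

Nonnegative : Pred ℝ 0ℓ
Nonnegative r = 0ℝ ≤ r

Integer : Pred ℝ 0ℓ
Integer r = ∃[ z ] r ≈ fromℤ z

Natural : Pred ℝ 0ℓ
Natural r = ∃[ n ] r ≈ fromℕℝ n

-- Points of ℝⁿ are equal when related by the coordinatewise equality _≋_.

open VectorEquality ≈-setoid public using (_≋_; ≋-setoid)

Subset : ℕ → Set₁
Subset n = Pred (Vector ℝ n) 0ℓ

ℤ^ : ∀ n → Subset n
ℤ^ n x = ∀ j → x j ∈ Integer

linearCombination : ∀ {m n} → Vector ℝ m → Vector (Vector ℝ n) m → Vector ℝ n
linearCombination c y j = sum λ i → c i * y i j

-- All finite linear combinations of elements of S with coefficients in C.
LinearCombinations : ∀ {n} → Pred ℝ 0ℓ → Subset n → Subset n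
LinearCombinations {n} C S x =
  ∃[ m ] Σ[ c ∈ Vector ℝ m ] Σ[ y ∈ Vector (Vector ℝ n) m ]
    (∀ i → c i ∈ C) × (∀ i → y i ∈ S) × x ≋ linearCombination c y

-- As above, with coefficients summing to 1.
AffineCombinations : ∀ {n} → Pred ℝ 0ℓ → Subset n → Subset n
AffineCombinations {n} C S x =
  ∃[ m ] Σ[ c ∈ Vector ℝ m ] Σ[ y ∈ Vector (Vector ℝ n) m ]
    (∀ i → c i ∈ C) × sum c ≈ 1ℝ × (∀ i → y i ∈ S) × x ≋ linearCombination c y

ConvexHull : ∀ {n} → Subset n → Subset n
ConvexHull = AffineCombinations Nonnegative

AffineHull : ∀ {n} → Subset n → Subset n
AffineHull = AffineCombinations U

Range : ∀ {m n} → Vector (Vector ℝ n) m → Subset n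
Range v x = ∃[ i ] x ≋ v i

IsConvexPolytope : ∀ {n} → Subset n → Set
IsConvexPolytope {n} P = ∃[ m ] Σ[ v ∈ Vector (Vector ℝ n) m ] P ≐ ConvexHull (Range v)

-- Vertices are the extreme points: points of P that do not lie in the
-- relative interior of a nondegenerate segment contained in P.
Vertex : ∀ {n} → Subset n → Subset n
Vertex P x = x ∈ P ×
  (∀ y z s t → y ∈ P → z ∈ P → 0ℝ < s → 0ℝ < t → s + t ≈ 1ℝ →
     x ≋ (λ j → s * y j + t * z j) → y ≋ z)

IsIntegralConvexPolytope : ∀ {n} → Subset n → Set
IsIntegralConvexPolytope {n} P = IsConvexPolytope P × Vertex P ⊆ ℤ^ n

AffinelyIndependent : ∀ {m n} → Vector (Vector ℝ n) m → Set
AffinelyIndependent {m} p = ∀ (c : Vector ℝ m) → sum c ≈ 0ℝ →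
  (∀ j → linearCombination c p j ≈ 0ℝ) → ∀ i → c i ≈ 0ℝ

-- The affine hull of P has an affine basis consisting of d + 1 points of P.
HasDimension : ∀ {n} → Subset n → ℕ → Set
HasDimension {n} P d = Σ[ p ∈ Vector (Vector ℝ n) (suc d) ]
  (∀ i → p i ∈ P) × AffinelyIndependent p × P ⊆ AffineHull (Range p)

atHeightOne : ∀ {n} → Vector ℝ n → Vector ℝ (suc n)
atHeightOne {n} α = insertAt α (fromℕ n) 1ℝ

-- The polytope P̃ ⊂ ℝⁿ⁺¹: the convex hull of the points (α , 1) with α ∈ P.
Homogenization : ∀ {n} → Subset n → Subset (suc n)
Homogenization P = ConvexHull λ x → ∃[ α ] α ∈ P × x ≋ atHeightOne α

𝒜 : ∀ {n} → Subset n → Subset (suc n)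
𝒜 {n} P = Homogenization P ∩ ℤ^ (suc n)

ℝ≥0𝒜 ℤ𝒜 ℤ≥0𝒜 : ∀ {n} → Subset n → Subset (suc n)
ℝ≥0𝒜 P = LinearCombinations Nonnegative (𝒜 P)
ℤ𝒜   P = LinearCombinations Integer (𝒜 P)
ℤ≥0𝒜 P = LinearCombinations Natural (𝒜 P)

Normal : ∀ {n} → Subset n → Set
Normal P = ℝ≥0𝒜 P ∩ ℤ𝒜 P ≐ ℤ≥0𝒜 P

Holes : ∀ {n} → Subset n → Subset (suc n)
Holes P = (ℝ≥0𝒜 P ∩ ℤ𝒜 P) ∖ ℤ≥0𝒜 P

-- Elements of S; two are equal when the underlying points are.
subsetSetoid : ∀ {n} → Subset n → Setoid 0ℓ 0ℓ
subsetSetoid {n} S = On.setoid {B = ∃ S} (≋-setoid n) proj₁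

HasCardinality : ∀ {n} → Subset n → ℕ → Set
HasCardinality S k = Bijection (≡.setoid (Fin k)) (subsetSetoid S)

Finite : ∀ {n} → Subset n → Set
Finite S = ∃[ k ] HasCardinality S k

VeryAmple : ∀ {n} → Subset n → Set
VeryAmple P = Finite (Holes P)

module Submission where

-- Take the convex hull of segments of length h standing over the vertices of a lattice polytope of
-- dimension d - 1: a unit square with corners (0,0), (1,0), (0,1), (1,1), joined with d - 3 further
-- apexes. Only the segment over (1,1) is moved, to start at K = 3h + 1 instead of 0. A lattice point of
-- height n in the cone is reached by t copies of (1,1) exactly when its fibre coordinate lies in
-- [tK , tK + hn]. For n ≥ 3 these intervals cover everything between the extreme values of t, since
-- K = 3h + 1. For n ≤ 2 more than one value of t occurs only over (0,0) + (1,1) = (1,0) + (0,1), and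
-- there [0 , 2h] and [3h + 1 , 5h + 1] leave exactly the h points 2h + 1, ..., 3h as holes.
--
-- A hole is in the real cone and in the lattice because twice the hole, and the hole plus a generator,
-- have height at least 3 and thus lie in the semigroup.
--
-- P is spanned by all lattice points of the segments, not only the end points; a vertex of P is then
-- one of these points, because a positive weight in a convex combination can be split off.

open import Algebra.Bundles using (module CommutativeRing)
import Algebra.Properties.CommutativeSemigroup as CommutativeSemigroup
import Algebra.Properties.Semiring.Sum as SemiringSum
open import Data.Fin.Base using (Fin; zero; suc; fromℕ; fromℕ<; inject₁; toℕ; combine; remQuot)
open import Data.Fin.Patterns using (0F; 1F; 2F; 3F; 4F)
import Data.Fin.Properties as Fin
open import Data.Fin.Relation.Unary.Top using (view; ‵fromℕ; ‵inject₁)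
open import Data.Nat.Base as ℕ using (ℕ; zero; suc; z≤n; s≤s; _≤_)
import Data.Nat.Properties as ℕ
open import Data.Product.Base using (∃-syntax; Σ-syntax; _×_; _,_; proj₁; proj₂)
open import Data.Rational.Base as ℚ using (ℚ; 0ℚ; 1ℚ; ½; ∣_∣)
import Data.Rational.Properties as ℚ
import Data.Rational.Solver as ℚ-Solver
open import Data.Rational.Unnormalised.Base as ℚᵘ using (mkℚᵘ; *≡*; *≤*)
import Data.Rational.Unnormalised.Properties as ℚᵘ
open import Data.Sum.Base using (_⊎_; inj₁; inj₂; [_,_]′)
open import Data.Unit.Base using (tt)
open import Data.Vec.Functional using (Vector; insertAt; updateAt; _∷_)
open import Data.Vec.Functional.Properties using (insertAt-lookup)
open import Function.Base using (_∘_)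
open import Level using (0ℓ)
open import Relation.Binary.Bundles using (Setoid)
open import Relation.Binary.PropositionalEquality as ≡ using (_≡_; _≗_; cong; cong₂; subst; subst₂)
import Relation.Binary.Reasoning.Setoid as SetoidReasoning
open import Relation.Nullary using (Dec; yes; no)
open import Relation.Nullary.Negation.Core using (¬_; contradiction)
open import Relation.Unary using (Pred; _∈_; _⊆_)

-- Between consecutive intervals at height n exactly K - 1 - hn = (3 - n)h integers are missing.
-- This is the origin of K: the gap has length h at height 2 and disappears from height 3 on.
--
-- The facets of P are never determined. Five relations that hold at the generators (the record
-- `Constraints`) pass to the whole cone, and every vector of natural numbers satisfying them is
-- shown to be decomposable or to be one of the h exceptions. To state these relations without
-- subtraction, a point carries the complements x′ and y′ of x and y as coordinates of their own, so
-- P of dimension d lies in a space of dimension d + 2.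
--
-- The order on Cauchy reals is not decidable. Case distinctions are therefore moved to ℕ and ℚ:
-- inequalities between reals are cancelled to inequalities between natural numbers at lattice
-- points, and a positive weight is detected through a rational approximation.

private
  module ℕΣ = SemiringSum ℕ.+-*-semiring
  module ℚΣ = SemiringSum (CommutativeRing.semiring ℚ.+-*-commutativeRing)

-- Lattice points and decompositions

insertAt-inject₁ : ∀ {A : Set} {n} (xs : Vector A n) v i → insertAt xs (fromℕ n) v (inject₁ i) ≡ xs i
insertAt-inject₁ {n = suc n} xs v zero    = ≡.refl
insertAt-inject₁ {n = suc n} xs v (suc i) = insertAt-inject₁ (xs ∘ suc) v i

unit : ∀ {m} → Fin m → Vector ℕ m
unit zero    = 1 ∷ λ _ → 0
unit (suc i) = 0 ∷ unit i

sum-*0 : ∀ {m} (u : Vector ℕ m) → ℕΣ.sum (λ i → u i ℕ.* 0) ≡ 0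
sum-*0 {zero}  u = ≡.refl
sum-*0 {suc m} u = cong₂ ℕ._+_ (ℕ.*-zeroʳ (u zero)) (sum-*0 (u ∘ suc))

sum-0s : ∀ m → ℕΣ.sum {m} (λ _ → 0) ≡ 0
sum-0s zero    = ≡.refl
sum-0s (suc m) = sum-0s m

sum-unit : ∀ {m} (i : Fin m) → ℕΣ.sum (unit i) ≡ 1
sum-unit {suc m} zero    = cong suc (sum-0s m)
sum-unit (suc i) = sum-unit i

sum-*-unit : ∀ {m} (u : Vector ℕ m) j → ℕΣ.sum (λ i → u i ℕ.* unit i j) ≡ u j
sum-*-unit u zero = ≡.trans (cong₂ ℕ._+_ (ℕ.*-identityʳ (u zero)) (sum-*0 (u ∘ suc)))
    (ℕ.+-identityʳ (u zero))
sum-*-unit u (suc j) = cong₂ ℕ._+_ (ℕ.*-zeroʳ (u zero)) (sum-*-unit (u ∘ suc) j)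

sum≡0⇒≡0 : ∀ {m} (u : Vector ℕ m) → ℕΣ.sum u ≡ 0 → ∀ i → u i ≡ 0
sum≡0⇒≡0 u eq zero    = ℕ.m+n≡0⇒m≡0 (u zero) eq
sum≡0⇒≡0 u eq (suc i) = sum≡0⇒≡0 (u ∘ suc) (ℕ.m+n≡0⇒n≡0 (u zero) eq) i

module Combinatorics (h m : ℕ) where

  open import Data.Nat.Base using (_+_; _*_; _∸_; _<_; _/_; _%_)
  open import Data.Nat.DivMod using (m≡m%n+[m/n]*n; m%n<n; m/n*n≤m)
  open import Data.Nat.Properties
  open import Data.Nat.Solver using (module +-*-Solver)
  open import Relation.Binary.PropositionalEquality using (refl; sym; trans)

  K : ℕ
  K = suc (3 * h)

  -- A point (z , x , x′ , y , y′ , u , n) of the cone over P; n is the height.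
  apex : Fin m → Fin (6 + m)
  apex i = suc (suc (suc (suc (suc (inject₁ i)))))

  height : Fin (6 + m)
  height = fromℕ (5 + m)

  -- The height comes after m apex coordinates, out of reach of a constructor pattern; `view` tells
  -- whether the remaining index is the top one.
  ext : {A : Set} {V W : Vector A (6 + m)} → (R : A → A → Set) →
        R (V 0F) (W 0F) → R (V 1F) (W 1F) → R (V 2F) (W 2F) → R (V 3F) (W 3F) → R (V 4F) (W 4F) →
        (∀ i → R (V (apex i)) (W (apex i))) → R (V height) (W height) → ∀ j → R (V j) (W j)
  ext R p₀ p₁ p₂ p₃ p₄ pᵤ pₙ 0F = p₀
  ext R p₀ p₁ p₂ p₃ p₄ pᵤ pₙ 1F = p₁
  ext R p₀ p₁ p₂ p₃ p₄ pᵤ pₙ 2F = p₂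
  ext R p₀ p₁ p₂ p₃ p₄ pᵤ pₙ 3F = p₃
  ext R p₀ p₁ p₂ p₃ p₄ pᵤ pₙ 4F = p₄
  ext R p₀ p₁ p₂ p₃ p₄ pᵤ pₙ (suc (suc (suc (suc (suc j))))) with view j
  ... | ‵fromℕ     = pₙ
  ... | ‵inject₁ i = pᵤ i

  -- The cases are the corners (0,0), (1,0), (0,1), (1,1) and the apexes, where j is the position on
  -- the segment. At a corner x′ = 1 - x and y′ = 1 - y; at an apex all four vanish, so that x + x′
  -- and y + y′ always count the corners used.
  generator : Fin (4 + m) → ℕ → Vector ℕ (5 + m)
  generator 0F j = j       ∷ 0 ∷ 1 ∷ 0 ∷ 1 ∷ λ _ → 0
  generator 1F j = j       ∷ 1 ∷ 0 ∷ 0 ∷ 1 ∷ λ _ → 0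
  generator 2F j = j       ∷ 0 ∷ 1 ∷ 1 ∷ 0 ∷ λ _ → 0
  generator 3F j = (j + K) ∷ 1 ∷ 0 ∷ 1 ∷ 0 ∷ λ _ → 0
  generator (suc (suc (suc (suc i)))) j = j ∷ 0 ∷ 0 ∷ 0 ∷ 0 ∷ unit i

  G : Fin (4 + m) → ℕ → Vector ℕ (6 + m)
  G b j = insertAt (generator b j) height 1

  hole : Fin h → Vector ℕ (6 + m)
  hole j = (suc (2 * h) + toℕ j) ∷ 1 ∷ 1 ∷ 1 ∷ 1 ∷ insertAt (λ _ → 0) (fromℕ m) 2

  -- Over given x, x′, y, y′ the number t of copies of (1,1) satisfies x - y′ ≤ t ≤ min (x , y).
  -- Each copy costs K and each generator adds at most h, which gives `lower`, `upperˣ` and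
  -- `upperʸ`.
  record Constraints (V : Vector ℕ (6 + m)) : Set where
    field
      square : V 1F + V 2F ≡ V 3F + V 4F
      total  : V 1F + V 2F + ℕΣ.sum (V ∘ apex) ≡ V height
      lower  : K * V 1F ≤ V 0F + K * V 4F
      upperˣ : V 0F ≤ K * V 1F + h * V height
      upperʸ : V 0F ≤ K * V 3F + h * V height

  -- t, a, b, c count the generators used over the corners (1,1), (1,0), (0,1), (0,0) of the square,
  -- and ζ is the sum of their heights above the lower ends of the segments.
  record Decomposition (V : Vector ℕ (6 + m)) : Set where
    field
      t a b c ζ : ℕ
      z≡ : V 0F ≡ ζ + t * K
      ζ≤ : ζ ≤ h * V height
      x≡ : V 1F ≡ t + a
      x′≡ : V 2F ≡ b + c
      y≡ : V 3F ≡ t + b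
      y′≡ : V 4F ≡ a + c
      n≡ : V height ≡ t + a + b + c + ℕΣ.sum (V ∘ apex)

  decomposition-resp : ∀ {V W} → V ≗ W → Decomposition V → Decomposition W
  decomposition-resp {V} {W} V≗W D = record
    { t = t ; a = a ; b = b ; c = c ; ζ = ζ
    ; z≡ = trans (sym (V≗W 0F)) z≡
    ; ζ≤ = subst (λ n → ζ ≤ h * n) (V≗W height) ζ≤
    ; x≡ = trans (sym (V≗W 1F)) x≡
    ; x′≡ = trans (sym (V≗W 2F)) x′≡
    ; y≡ = trans (sym (V≗W 3F)) y≡
    ; y′≡ = trans (sym (V≗W 4F)) y′≡
    ; n≡ = trans (sym (V≗W height)) (trans n≡ (cong ((t + a + b + c) +_) (ℕΣ.sum-cong-≗ (V≗W ∘ apex))))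
    }
    where open Decomposition D

  decomposition-0 : Decomposition (λ _ → 0)
  decomposition-0 = record
    { t = 0 ; a = 0 ; b = 0 ; c = 0 ; ζ = 0
    ; z≡ = refl ; ζ≤ = z≤n ; x≡ = refl ; x′≡ = refl ; y≡ = refl ; y′≡ = refl ; n≡ = sym (sum-0s m) }

  decomposition-∷ : ∀ k {V W} → Decomposition V → Decomposition W → Decomposition (λ j → k * V j + W j)
  decomposition-∷ k {V} {W} D E = record
    { t = k * D.t + E.t ; a = k * D.a + E.a ; b = k * D.b + E.b ; c = k * D.c + E.c ; ζ = k * D.ζ + E.ζ
    ; z≡ = trans (cong₂ (λ p q → k * p + q) D.z≡ E.z≡) (arrange D.ζ D.t E.ζ E.t K)
    ; ζ≤ = ≤-trans (+-mono-≤ (*-monoʳ-≤ k D.ζ≤) E.ζ≤) (≤-reflexive (distrib (V height) (W height)))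
    ; x≡ = trans (cong₂ (λ p q → k * p + q) D.x≡ E.x≡) (arrange′ D.t D.a E.t E.a)
    ; x′≡ = trans (cong₂ (λ p q → k * p + q) D.x′≡ E.x′≡) (arrange′ D.b D.c E.b E.c)
    ; y≡ = trans (cong₂ (λ p q → k * p + q) D.y≡ E.y≡) (arrange′ D.t D.b E.t E.b)
    ; y′≡ = trans (cong₂ (λ p q → k * p + q) D.y′≡ E.y′≡) (arrange′ D.a D.c E.a E.c)
    ; n≡ = trans (cong₂ (λ p q → k * p + q) D.n≡ E.n≡)
        (trans (arrange″ D.t D.a D.b D.c (ℕΣ.sum (V ∘ apex)) E.t E.a E.b E.c (ℕΣ.sum (W ∘ apex)))
          (cong (_ +_) (sym (trans (ℕΣ.∑-distrib-+ (λ i → k * V (apex i)) (W ∘ apex))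
            (cong (_+ ℕΣ.sum (W ∘ apex)) (sym (ℕΣ.*-distribˡ-sum k (V ∘ apex))))))))
    }
    where
    open +-*-Solver
    module D = Decomposition D
    module E = Decomposition E
    arrange : ∀ ζ t ζ′ t′ K → k * (ζ + t * K) + (ζ′ + t′ * K) ≡ (k * ζ + ζ′) + (k * t + t′) * K
    arrange = solve 6 (λ k ζ t ζ′ t′ K → k :* (ζ :+ t :* K) :+ (ζ′ :+ t′ :* K)
        := (k :* ζ :+ ζ′) :+ (k :* t :+ t′) :* K) refl k
    arrange′ : ∀ p q p′ q′ → k * (p + q) + (p′ + q′) ≡ (k * p + p′) + (k * q + q′)
    arrange′ = solve 5 (λ k p q p′ q′ → k :* (p :+ q) :+ (p′ :+ q′) := (k :* p :+ p′) :+ (k :* q :+ q′))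
        refl k
    distrib : ∀ p q → k * (h * p) + h * q ≡ h * (k * p + q)
    distrib = solve 4 (λ k h p q → k :* (h :* p) :+ h :* q := h :* (k :* p :+ q)) refl k h
    arrange″ : ∀ t a b c s t′ a′ b′ c′ s′ →
      k * (t + a + b + c + s) + (t′ + a′ + b′ + c′ + s′) ≡
      (k * t + t′) + (k * a + a′) + (k * b + b′) + (k * c + c′) + (k * s + s′)
    arrange″ = solve 11 (λ k t a b c s t′ a′ b′ c′ s′ →
      k :* (t :+ a :+ b :+ c :+ s) :+ (t′ :+ a′ :+ b′ :+ c′ :+ s′) :=
      (k :* t :+ t′) :+ (k :* a :+ a′) :+ (k :* b :+ b′) :+ (k :* c :+ c′) :+ (k :* s :+ s′)) refl k

  -- Without (1,1) the fibre coordinate is at most 2h, which is too small; a single copy of (1,1)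
  -- already brings it to 3h + 1, which is too large.
  ¬decomposition-hole : ∀ j → ¬ Decomposition (hole j)
  ¬decomposition-hole j record { t = zero ; ζ = ζ ; z≡ = z≡ ; ζ≤ = ζ≤ } = contradiction
    (begin
      suc (2 * h)           ≤⟨ m≤m+n (suc (2 * h)) (toℕ j) ⟩
      suc (2 * h) + toℕ j   ≡⟨ trans z≡ (+-identityʳ ζ) ⟩
      ζ                     ≤⟨ ζ≤ ⟩
      h * hole j height     ≡⟨ cong (h *_) (insertAt-lookup (λ _ → 0) (fromℕ m) 2) ⟩
      h * 2                 ≡⟨ *-comm h 2 ⟩
      2 * h                 ∎) (<-irrefl refl)
    where open ≤-Reasoning
  ¬decomposition-hole j record { t = suc t ; ζ = ζ ; z≡ = z≡ } = contradiction
    (begin-strict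
      suc (2 * h) + toℕ j   <⟨ +-monoʳ-< (suc (2 * h)) (Fin.toℕ<n j) ⟩
      suc (2 * h) + h       ≡⟨ cong suc (+-comm (2 * h) h) ⟩
      K                     ≤⟨ m≤m+n K (t * K) ⟩
      suc t * K             ≤⟨ m≤n+m (suc t * K) ζ ⟩
      ζ + suc t * K         ≡⟨ z≡ ⟨
      suc (2 * h) + toℕ j   ∎) (<-irrefl refl)
    where open ≤-Reasoning

  -- Greedy decomposition of a lattice point

  private
    z<[1+z/K]*K : ∀ z → z < suc (z / K) * K
    z<[1+z/K]*K z = begin-strict
      z                      ≡⟨ m≡m%n+[m/n]*n z K ⟩
      z % K + z / K * K      <⟨ +-monoˡ-< (z / K * K) (m%n<n z K) ⟩
      suc (z / K) * K        ∎
      where open ≤-Reasoning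

    -- Here `lower` is used: when z / K copies of (1,1) are taken, the other x - z / K units of x
    -- still fit under y′ as copies of (1,0).
    x≤z/K+y′ : ∀ x y′ z → K * x ≤ z + K * y′ → x ≤ z / K + y′
    x≤z/K+y′ x y′ z lower = ℕ.s≤s⁻¹ (*-cancelˡ-< K x (suc (z / K) + y′) (begin-strict
      K * x                        ≤⟨ lower ⟩
      z + K * y′                   <⟨ +-monoˡ-< (K * y′) (z<[1+z/K]*K z) ⟩
      suc (z / K) * K + K * y′     ≡⟨ cong (_+ K * y′) (*-comm (suc (z / K)) K) ⟩
      K * suc (z / K) + K * y′     ≡⟨ *-distribˡ-+ K (suc (z / K)) y′ ⟨
      K * (suc (z / K) + y′)       ∎))
      where open ≤-Reasoning

    -- The largest t ≤ min (x , y) with t K ≤ z.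
    corner-multiplicity : ∀ {x x′ y y′ z} → x + x′ ≡ y + y′ → K * x ≤ z + K * y′ →
      ∃[ t ] t ≤ x × t ≤ y × t * K ≤ z × x ≤ t + y′ × (t ≡ x ⊎ t ≡ y ⊎ z < suc t * K)
    corner-multiplicity {x} {x′} {y} {y′} {z} square lower
      with ≤-total x y | ≤-total x (z / K) | ≤-total y (z / K)
    ... | inj₁ x≤y | inj₁ x≤q | _ =
      x , ≤-refl , x≤y , ≤-trans (*-monoˡ-≤ K x≤q) (m/n*n≤m z K) , m≤m+n x y′ , inj₁ refl
    ... | inj₂ y≤x | _ | inj₁ y≤q =
      y , y≤x , ≤-refl , ≤-trans (*-monoˡ-≤ K y≤q) (m/n*n≤m z K) ,
      ≤-trans (m≤m+n x x′) (≤-reflexive square) , inj₂ (inj₁ refl)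
    ... | inj₁ x≤y | inj₂ q≤x | _ =
      z / K , q≤x , ≤-trans q≤x x≤y , m/n*n≤m z K , x≤z/K+y′ x y′ z lower , inj₂ (inj₂ (z<[1+z/K]*K z))
    ... | inj₂ y≤x | _ | inj₂ q≤y =
      z / K , ≤-trans q≤y y≤x , q≤y , m/n*n≤m z K , x≤z/K+y′ x y′ z lower , inj₂ (inj₂ (z<[1+z/K]*K z))

  IsHole : Vector ℕ (6 + m) → Set
  IsHole V = ∃[ j ] V ≗ hole j

  private
    -- At height at most 2, one copy each of (1,0) and (0,1) leaves room for nothing else. This
    -- singles out the one fibre that has holes.
    short-total : ∀ {t a b c s n} → n ≡ t + suc a + suc b + c + s → n < 3 →
      t ≡ 0 × a ≡ 0 × b ≡ 0 × c ≡ 0 × s ≡ 0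
    short-total {t} {a} {b} {c} {s} {n} n≡ n<3 =
      m+n≡0⇒m≡0 t (m+n≡0⇒m≡0 (t + a) (m+n≡0⇒m≡0 (t + a + b) (m+n≡0⇒m≡0 (t + a + b + c) r≡0))) ,
      m+n≡0⇒n≡0 t (m+n≡0⇒m≡0 (t + a) (m+n≡0⇒m≡0 (t + a + b) (m+n≡0⇒m≡0 (t + a + b + c) r≡0))) ,
      m+n≡0⇒n≡0 (t + a) (m+n≡0⇒m≡0 (t + a + b) (m+n≡0⇒m≡0 (t + a + b + c) r≡0)) ,
      m+n≡0⇒n≡0 (t + a + b) (m+n≡0⇒m≡0 (t + a + b + c) r≡0) ,
      m+n≡0⇒n≡0 (t + a + b + c) r≡0
      where
      open +-*-Solver
      r≡0 : t + a + b + c + s ≡ 0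
      r≡0 = n<1⇒n≡0 (+-cancelˡ-< 2 (t + a + b + c + s) 1 (subst (_< 3)
        (trans n≡ (solve 5 (λ t a b c s →
          t :+ (con 1 :+ a) :+ (con 1 :+ b) :+ c :+ s := con 2 :+ (t :+ a :+ b :+ c :+ s))
              refl t a b c s)) n<3))

    -- Suppose z - tK exceeds the capacity hn although t is maximal. If a = 0 then t = x, against
    -- `upperˣ`; if b = 0 then t = y, against `upperʸ`. So both are positive, t was stopped by z <
    -- (t + 1)K, and the height is too small for the next interval to be reached.
    overflow⇒hole : ∀ V t a b c → V 1F ≡ t + a → V 2F ≡ b + c → V 3F ≡ t + b → V 4F ≡ a + c →
      V height ≡ t + a + b + c + ℕΣ.sum (V ∘ apex) →
      V 0F ≤ K * V 1F + h * V height → V 0F ≤ K * V 3F + h * V height →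
      t ≡ V 1F ⊎ t ≡ V 3F ⊎ V 0F < suc t * K →
      h * V height + t * K < V 0F → IsHole V
    overflow⇒hole V t zero b c x≡ x′≡ y≡ y′≡ n≡ upx upy _ over = contradiction (begin-strict
      V 0F                          ≤⟨ upx ⟩
      K * V 1F + h * V height       ≡⟨ cong (λ x → K * x + h * V height) (trans x≡ (+-identityʳ t)) ⟩
      K * t + h * V height          ≡⟨ +-comm (K * t) (h * V height) ⟩
      h * V height + K * t          ≡⟨ cong (h * V height +_) (*-comm K t) ⟩
      h * V height + t * K          <⟨ over ⟩
      V 0F                          ∎) (<-irrefl refl)
      where open ≤-Reasoning
    overflow⇒hole V t (suc a) zero c x≡ x′≡ y≡ y′≡ n≡ upx upy _ over = contradiction (begin-strict
      V 0F                          ≤⟨ upy ⟩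
      K * V 3F + h * V height       ≡⟨ cong (λ y → K * y + h * V height) (trans y≡ (+-identityʳ t)) ⟩
      K * t + h * V height          ≡⟨ +-comm (K * t) (h * V height) ⟩
      h * V height + K * t          ≡⟨ cong (h * V height +_) (*-comm K t) ⟩
      h * V height + t * K          <⟨ over ⟩
      V 0F                          ∎) (<-irrefl refl)
      where open ≤-Reasoning
    overflow⇒hole V t (suc a) (suc b) c x≡ x′≡ y≡ y′≡ n≡ upx upy (inj₁ t≡x) over =
      contradiction (trans t≡x (trans x≡ (+-suc t a))) (m≢1+m+n t)
    overflow⇒hole V t (suc a) (suc b) c x≡ x′≡ y≡ y′≡ n≡ upx upy (inj₂ (inj₁ t≡y)) over =
      contradiction (trans t≡y (trans y≡ (+-suc t b))) (m≢1+m+n t)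
    overflow⇒hole V t (suc a) (suc b) c x≡ x′≡ y≡ y′≡ n≡ upx upy (inj₂ (inj₂ z<)) over
      with short-total {t} {a} {b} {c} n≡ n<3
      where
      open ≤-Reasoning
      -- As `K` is `suc (3 * h)`, the bound z < (t + 1)K says z ≤ 3h + tK; together with hn + tK < z
      -- this leaves hn < 3h.
      n<3 : V height < 3
      n<3 = *-cancelˡ-< h (V height) 3 (+-cancelʳ-< (t * K) (h * V height) (h * 3) (begin-strict
        h * V height + t * K <⟨ over ⟩
        V 0F                 ≤⟨ ℕ.s≤s⁻¹ z< ⟩
        3 * h + t * K        ≡⟨ cong (_+ t * K) (*-comm 3 h) ⟩
        h * 3 + t * K        ∎))
    ... | refl , refl , refl , refl , s≡0 = fromℕ< j<h ,
      ext _≡_ z≡ x≡ x′≡ y≡ y′≡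
        (λ i → trans (sum≡0⇒≡0 (V ∘ apex) s≡0 i) (sym (insertAt-inject₁ {n = m} (λ _ → 0) 2 i)))
        (trans n≡2 (sym (insertAt-lookup (λ _ → 0) (fromℕ m) 2)))
      where
      open ≤-Reasoning
      n≡2 : V height ≡ 2
      n≡2 = trans n≡ (cong (2 +_) s≡0)
      2h<z : suc (2 * h) ≤ V 0F
      2h<z = subst (_< V 0F) (trans (+-identityʳ _) (trans (cong (h *_) n≡2) (*-comm h 2))) over
      j<h : V 0F ∸ suc (2 * h) < h
      j<h = +-cancelˡ-< (suc (2 * h)) (V 0F ∸ suc (2 * h)) h (begin-strict
        suc (2 * h) + (V 0F ∸ suc (2 * h))  ≡⟨ m+[n∸m]≡n 2h<z ⟩
        V 0F                                <⟨ z< ⟩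
        K + 0                               ≡⟨ +-identityʳ K ⟩
        K                                   ≡⟨ cong suc (+-comm h (2 * h)) ⟩
        suc (2 * h) + h                     ∎)
      z≡ : V 0F ≡ suc (2 * h) + toℕ (fromℕ< j<h)
      z≡ = sym (trans (cong (suc (2 * h) +_) (Fin.toℕ-fromℕ< j<h)) (m+[n∸m]≡n 2h<z))

  -- The choice of t determines a, b, c and ζ = z - tK. The largest admissible t makes ζ smallest,
  -- so ζ ≤ hn is the only condition that can fail.
  decomposition⊎hole : ∀ V → Constraints V → Decomposition V ⊎ IsHole V
  decomposition⊎hole V C with corner-multiplicity square lower
    where open Constraints C
  ... | t , t≤x , t≤y , tK≤z , x≤t+y′ , maximal = decide (z ∸ t * K ≤? h * V height)
    where
    open Constraints C
    open ≤-Reasoning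
    open +-*-Solver
    z = V 0F
    a = V 1F ∸ t
    b = V 3F ∸ t
    x≡ : V 1F ≡ t + a
    x≡ = sym (m+[n∸m]≡n t≤x)
    y≡ : V 3F ≡ t + b
    y≡ = sym (m+[n∸m]≡n t≤y)
    -- Needed for b ≤ x′, without which the truncated difference c would lose its meaning; it is x ≤
    -- t + y′ carried over by the square relation.
    y≤t+x′ : V 3F ≤ t + V 2F
    y≤t+x′ = +-cancelˡ-≤ (V 1F) (V 3F) (t + V 2F) (begin
      V 1F + V 3F           ≤⟨ +-monoˡ-≤ (V 3F) x≤t+y′ ⟩
      t + V 4F + V 3F       ≡⟨ solve 3 (λ t y′ y → t :+ y′ :+ y := t :+ (y :+ y′)) refl t (V 4F) (V 3F) ⟩
      t + (V 3F + V 4F)     ≡⟨ cong (t +_) square ⟨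
      t + (V 1F + V 2F)     ≡⟨ solve 3 (λ t x x′ → t :+ (x :+ x′) := x :+ (t :+ x′)) refl t (V 1F) (V 2F) ⟩
      V 1F + (t + V 2F)     ∎)
    b≤x′ : b ≤ V 2F
    b≤x′ = m≤n+o⇒m∸n≤o (V 3F) t y≤t+x′
    c = V 2F ∸ b
    x′≡ : V 2F ≡ b + c
    x′≡ = sym (m+[n∸m]≡n b≤x′)
    y′≡ : V 4F ≡ a + c
    y′≡ = +-cancelˡ-≡ (V 3F) (V 4F) (a + c) (begin-equality
      V 3F + V 4F         ≡⟨ square ⟨
      V 1F + V 2F         ≡⟨ cong₂ _+_ x≡ x′≡ ⟩
      t + a + (b + c)     ≡⟨ solve 4 (λ t a b c → t :+ a :+ (b :+ c) := t :+ b :+ (a :+ c)) refl t a b c ⟩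
      t + b + (a + c)     ≡⟨ cong (_+ (a + c)) y≡ ⟨
      V 3F + (a + c)      ∎)
    n≡ : V height ≡ t + a + b + c + ℕΣ.sum (V ∘ apex)
    n≡ = trans (sym total) (cong (_+ ℕΣ.sum (V ∘ apex))
        (trans (cong₂ _+_ x≡ x′≡) (sym (+-assoc (t + a) b c))))
    decide : Dec (z ∸ t * K ≤ h * V height) → Decomposition V ⊎ IsHole V
    decide (yes ζ≤) = inj₁ record
      { t = t ; a = a ; b = b ; c = c ; ζ = z ∸ t * K ; z≡ = sym (m∸n+n≡m tK≤z) ; ζ≤ = ζ≤
      ; x≡ = x≡ ; x′≡ = x′≡ ; y≡ = y≡ ; y′≡ = y′≡ ; n≡ = n≡ }
    decide (no ζ≰) = inj₂ (overflow⇒hole V t a b c x≡ x′≡ y≡ y′≡ n≡ upperˣ upperʸ maximal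
      (subst (h * V height + t * K <_) (m∸n+n≡m tK≤z) (+-monoˡ-< (t * K) (≰⇒> ζ≰))))

  -- The fibre coordinate 4h + 2 + 2j minus one K leaves h + 1 + 2j, which is below 3h because j < h
  -- and so fits into the capacity 4h of height 4. Each corner is used once.
  decomposition-2hole : ∀ j → Decomposition (λ l → 2 * hole j l)
  decomposition-2hole j = record
    { t = 1 ; a = 1 ; b = 1 ; c = 1 ; ζ = suc (h + 2 * toℕ j)
    ; z≡ = solve 2 (λ h j → con 2 :* ((con 1 :+ con 2 :* h) :+ j) :=
        (con 1 :+ (h :+ con 2 :* j)) :+ con 1 :* (con 1 :+ con 3 :* h)) refl h (toℕ j)
    ; ζ≤ = begin
        suc (h + 2 * toℕ j)       ≤⟨ n≤1+n _ ⟩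
        suc (suc (h + 2 * toℕ j)) ≡⟨ solve 2 (λ h j → con 2 :+ (h :+ con 2 :* j)
            := h :+ con 2 :* (con 1 :+ j)) refl h (toℕ j) ⟩
        h + 2 * suc (toℕ j)       ≤⟨ +-monoʳ-≤ h (*-monoʳ-≤ 2 (Fin.toℕ<n j)) ⟩
        h + 2 * h                 ≤⟨ m≤n+m (h + 2 * h) h ⟩
        4 * h                     ≡⟨ *-comm 4 h ⟩
        h * 4                     ≡⟨ cong (λ n → h * (2 * n)) hole-height ⟨
        h * (2 * hole j height)   ∎
    ; x≡ = refl ; x′≡ = refl ; y≡ = refl ; y′≡ = refl
    ; n≡ = trans (cong (2 *_) hole-height) (cong (4 +_) (sym (trans
        (ℕΣ.sum-cong-≗ (λ i → cong (2 *_) (insertAt-inject₁ {n = m} (λ _ → 0) 2 i))) (sum-0s m))))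
    }
    where
    open ≤-Reasoning
    open +-*-Solver
    hole-height : hole j height ≡ 2
    hole-height = insertAt-lookup (λ _ → 0) (fromℕ m) 2

  -- The additional (0,0) raises the capacity from 2h to 3h, and 2h + 1 + j ≤ 3h because j < h. Then
  -- (1,1) can be avoided.
  decomposition-hole+G : ∀ j → Decomposition (λ l → hole j l + G 0F 0 l)
  decomposition-hole+G j = record
    { t = 0 ; a = 1 ; b = 1 ; c = 1 ; ζ = suc (2 * h) + toℕ j
    ; z≡ = refl
    ; ζ≤ = begin
        suc (2 * h) + toℕ j                ≡⟨ +-suc (2 * h) (toℕ j) ⟨
        2 * h + suc (toℕ j)                ≤⟨ +-monoʳ-≤ (2 * h) (Fin.toℕ<n j) ⟩
        2 * h + h                          ≡⟨ solve 1 (λ h → con 2 :* h :+ h := h :* con 3) refl h ⟩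
        h * 3                              ≡⟨ cong (h *_) total-height ⟨
        h * (hole j height + G 0F 0 height) ∎
    ; x≡ = refl ; x′≡ = refl ; y≡ = refl ; y′≡ = refl
    ; n≡ = trans total-height (cong (3 +_) (sym (trans
        (ℕΣ.sum-cong-≗ (λ i → cong₂ _+_ (insertAt-inject₁ {n = m} (λ _ → 0) 2 i)
            (insertAt-inject₁ {n = m} (λ _ → 0) 1 i))) (sum-0s m))))
    }
    where
    open ≤-Reasoning
    open +-*-Solver
    total-height : hole j height + G 0F 0 height ≡ 3
    total-height = cong₂ _+_ (insertAt-lookup (λ _ → 0) (fromℕ m) 2) (insertAt-lookup (λ _ → 0) (fromℕ m) 1)

  -- Separates two tasks: `recombine` adds up the lower ends of the segments with multiplicity, and
  -- `raise` puts the whole of ζ on top, to be distributed among the generators later.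
  raise : ℕ → Vector ℕ (6 + m) → Vector ℕ (6 + m)
  raise ζ V zero    = ζ + V zero
  raise ζ V (suc j) = V (suc j)

  recombine : (t a b c : ℕ) → Vector ℕ m → Vector ℕ (6 + m)
  recombine t a b c u j = c * G 0F 0 j + (a * G 1F 0 j + (b * G 2F 0 j + (t * G 3F 0 j +
    ℕΣ.sum λ i → u i * G (suc (suc (suc (suc i)))) 0 j)))

  G-height : ∀ b j → G b j height ≡ 1
  G-height b j = insertAt-lookup (λ i → generator b j (suc (suc (suc (suc (suc i)))))) (fromℕ m) 1

  G-apex : ∀ b j i → G b j (apex i) ≡ generator b j (suc (suc (suc (suc (suc i)))))
  G-apex b j = insertAt-inject₁ (λ i → generator b j (suc (suc (suc (suc (suc i)))))) 1

  recombine-decomposition : ∀ V (D : Decomposition V) → let open Decomposition D in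
    raise ζ (recombine t a b c (V ∘ apex)) ≗ V
  recombine-decomposition V D = ext _≡_
    (trans (cong (λ s → ζ + (c * 0 + (a * 0 + (b * 0 + (t * K + s))))) (sum-*0 u))
      (trans (solve 6 (λ ζ c a b t K → ζ :+ (c :* con 0 :+
          (a :* con 0 :+ (b :* con 0 :+ (t :* K :+ con 0)))) := ζ :+ t :* K) refl ζ c a b t K) (sym z≡)))
    (trans (cong (λ s → c * 0 + (a * 1 + (b * 0 + (t * 1 + s)))) (sum-*0 u))
      (trans (solve 4 (λ c a b t → c :* con 0 :+ (a :* con 1 :+ (b :* con 0 :+ (t :* con 1 :+ con 0)))
          := t :+ a) refl c a b t) (sym x≡)))
    (trans (cong (λ s → c * 1 + (a * 0 + (b * 1 + (t * 0 + s)))) (sum-*0 u))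
      (trans (solve 4 (λ c a b t → c :* con 1 :+ (a :* con 0 :+ (b :* con 1 :+ (t :* con 0 :+ con 0)))
          := b :+ c) refl c a b t) (sym x′≡)))
    (trans (cong (λ s → c * 0 + (a * 0 + (b * 1 + (t * 1 + s)))) (sum-*0 u))
      (trans (solve 4 (λ c a b t → c :* con 0 :+ (a :* con 0 :+ (b :* con 1 :+ (t :* con 1 :+ con 0)))
          := t :+ b) refl c a b t) (sym y≡)))
    (trans (cong (λ s → c * 1 + (a * 1 + (b * 0 + (t * 0 + s)))) (sum-*0 u))
      (trans (solve 4 (λ c a b t → c :* con 1 :+ (a :* con 1 :+ (b :* con 0 :+ (t :* con 0 :+ con 0)))
          := a :+ c) refl c a b t) (sym y′≡)))
    (λ i → trans (cong₂ (λ p s → c * p + (a * p + (b * p + (t * p + s)))) (G-apex 0F 0 i)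
        (trans (ℕΣ.sum-cong-≗ λ l → cong (u l *_) (G-apex (suc (suc (suc (suc l)))) 0 i)) (sum-*-unit u i)))
      (solve 5 (λ c a b t u → c :* con 0 :+ (a :* con 0 :+ (b :* con 0 :+ (t :* con 0 :+ u))) := u)
          refl c a b t (u i)))
    (trans (cong₂ (λ p s → c * p + (a * p + (b * p + (t * p + s)))) (G-height 0F 0)
        (ℕΣ.sum-cong-≗ λ l → trans (cong (u l *_) (G-height (suc (suc (suc (suc l)))) 0))
            (*-identityʳ (u l))))
      (trans (solve 5 (λ c a b t s → c :* con 1 :+ (a :* con 1 :+ (b :* con 1 :+ (t :* con 1 :+ s)))
          := t :+ a :+ b :+ c :+ s) refl c a b t (ℕΣ.sum u)) (sym n≡)))
    where
    open Decomposition D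
    open +-*-Solver
    u = V ∘ apex

  sum-G-apex : ∀ b j → ℕΣ.sum (G b j ∘ apex) ≡ ℕΣ.sum (λ i → generator b j (suc (suc (suc (suc (suc i))))))
  sum-G-apex b j = ℕΣ.sum-cong-≗ (G-apex b j)

  G-constraints : ∀ b j → j ≤ h → Constraints (G b j)
  G-constraints b j j≤h = record
    { square = square b
    ; total  = trans (cong (G b j 1F + G b j 2F +_) (sum-G-apex b j)) (trans (total b) (sym (G-height b j)))
    ; lower  = lower b
    ; upperˣ = subst (λ n → G b j 0F ≤ K * G b j 1F + h * n) (sym (G-height b j)) (upperˣ b)
    ; upperʸ = subst (λ n → G b j 0F ≤ K * G b j 3F + h * n) (sym (G-height b j)) (upperʸ b)
    }
    where
    square : ∀ b → G b j 1F + G b j 2F ≡ G b j 3F + G b j 4F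
    square 0F = refl
    square 1F = refl
    square 2F = refl
    square 3F = refl
    square (suc (suc (suc (suc i)))) = refl

    total : ∀ b → G b j 1F + G b j 2F + ℕΣ.sum (λ i → generator b j (suc (suc (suc (suc (suc i)))))) ≡ 1
    total 0F = cong suc (sum-0s m)
    total 1F = cong suc (sum-0s m)
    total 2F = cong suc (sum-0s m)
    total 3F = cong suc (sum-0s m)
    total (suc (suc (suc (suc i)))) = sum-unit i

    K*0≤ : ∀ z → K * 0 ≤ z
    K*0≤ z = ≤-trans (≤-reflexive (*-zeroʳ K)) z≤n

    lower : ∀ b → K * G b j 1F ≤ G b j 0F + K * G b j 4F
    lower 0F = K*0≤ _
    lower 1F = m≤n+m (K * 1) j
    lower 2F = K*0≤ _
    lower 3F = ≤-trans (≤-reflexive (*-identityʳ K)) (≤-trans (m≤n+m K j) (m≤m+n (j + K) (K * 0)))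
    lower (suc (suc (suc (suc i)))) = K*0≤ _

    j≤ : ∀ q → j ≤ q + h * 1
    j≤ q = ≤-trans j≤h (≤-trans (≤-reflexive (sym (*-identityʳ h))) (m≤n+m (h * 1) q))

    j+K≤ : j + K ≤ K * 1 + h * 1
    j+K≤ = ≤-trans (≤-reflexive (+-comm j K))
      (+-mono-≤ (≤-reflexive (sym (*-identityʳ K))) (≤-trans j≤h (≤-reflexive (sym (*-identityʳ h)))))

    upperˣ : ∀ b → G b j 0F ≤ K * G b j 1F + h * 1
    upperˣ 0F = j≤ _
    upperˣ 1F = j≤ _
    upperˣ 2F = j≤ _
    upperˣ 3F = j+K≤
    upperˣ (suc (suc (suc (suc i)))) = j≤ _

    upperʸ : ∀ b → G b j 0F ≤ K * G b j 3F + h * 1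
    upperʸ 0F = j≤ _
    upperʸ 1F = j≤ _
    upperʸ 2F = j≤ _
    upperʸ 3F = j+K≤
    upperʸ (suc (suc (suc (suc i)))) = j≤ _

-- Real numbers

-- ℝ is a record with η, so comparing two convertible reals compares their Cauchy proofs, which is
-- infeasible. Hence the explicit arguments, and steps by pointwise-≈ whose sequences agree by refl.

open import Data.Integer.Base as ℤ using (ℤ; +_)
import Data.Integer.Properties as ℤ
open import Defs hiding (_≤_)
open Defs using () renaming (_≤_ to infix 4 _≤ʳ_)
open ℚ-Solver.+-*-Solver using (solve; _:=_; _:+_; _:*_; :-_; con)
open Setoid ≈-setoid using () renaming (refl to ≈-refl′; sym to ≈-sym′; trans to ≈-trans′)
≈-refl : ∀ x → x ≈ x
≈-refl x = ≈-refl′ {x}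

≈-sym : ∀ x y → x ≈ y → y ≈ x
≈-sym x y = ≈-sym′ {x} {y}

≈-trans : ∀ x y z → x ≈ y → y ≈ z → x ≈ z
≈-trans x y z = ≈-trans′ {x} {y} {z}

½ε>0 : ∀ {ε} → 0ℚ ℚ.< ε → 0ℚ ℚ.< ½ ℚ.* ε
½ε>0 = ℚ.*-monoʳ-<-pos ½

½ε+½ε≡ε : ∀ ε → ½ ℚ.* ε ℚ.+ ½ ℚ.* ε ≡ ε
½ε+½ε≡ε ε = ≡.trans (≡.sym (ℚ.*-distribʳ-+ ε ½ ½)) (ℚ.*-identityˡ ε)

p≤∣p∣ : ∀ p → p ℚ.≤ ∣ p ∣
p≤∣p∣ p with ℚ.≤-total 0ℚ p
... | inj₁ 0≤p = ℚ.≤-reflexive (≡.sym (ℚ.0≤p⇒∣p∣≡p 0≤p))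
... | inj₂ p≤0 = ℚ.≤-trans p≤0 (ℚ.0≤∣p∣ p)

∣p-q∣≤⇒p≤q+ : ∀ p q {ε} → ∣ p ℚ.- q ∣ ℚ.≤ ε → p ℚ.≤ q ℚ.+ ε
∣p-q∣≤⇒p≤q+ p q {ε} ∣p-q∣≤ε = subst (ℚ._≤ q ℚ.+ ε)
  (solve 2 (λ p q → q :+ (p :+ :- q) := p) ≡.refl p q)
  (ℚ.+-monoʳ-≤ q (ℚ.≤-trans (p≤∣p∣ (p ℚ.- q)) ∣p-q∣≤ε))

≤+⇒∣-∣≤ : ∀ p q {ε} → p ℚ.≤ q ℚ.+ ε → q ℚ.≤ p ℚ.+ ε → ∣ p ℚ.- q ∣ ℚ.≤ ε
≤+⇒∣-∣≤ p q {ε} p≤q+ε q≤p+ε with ℚ.∣p∣≡p∨∣p∣≡-p (p ℚ.- q)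
... | inj₁ eq = subst₂ ℚ._≤_ (≡.sym eq)
  (solve 2 (λ q ε → (q :+ ε) :+ :- q := ε) ≡.refl q ε) (ℚ.+-monoˡ-≤ (ℚ.- q) p≤q+ε)
... | inj₂ eq = subst₂ ℚ._≤_
  (≡.trans (solve 2 (λ p q → q :+ :- p := :- (p :+ :- q)) ≡.refl p q) (≡.sym eq))
  (solve 2 (λ p ε → (p :+ ε) :+ :- p := ε) ≡.refl p ε) (ℚ.+-monoˡ-≤ (ℚ.- p) q≤p+ε)

eventually₂ : ∀ {P Q R : ℕ → Set} → (∀ n → P n → Q n → R n) →
              Eventually P → Eventually Q → Eventually R
eventually₂ f (M , p) (N , q) = M ℕ.⊔ N , λ n le →
  f n (p n (ℕ.m⊔n≤o⇒m≤o M N le)) (q n (ℕ.m⊔n≤o⇒n≤o M N le))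

always : ∀ {P : ℕ → Set} → (∀ n → P n) → Eventually P
always p = 0 , λ n _ → p n

pointwise-≈ : ∀ x y → (∀ n → seq x n ≡ seq y n) → x ≈ y
pointwise-≈ x y eq ε ε>0 = always λ n → ℚ.≤-trans
  (ℚ.≤-reflexive (cong ∣_∣ (≡.trans (cong (ℚ._- seq y n) (eq n)) (ℚ.+-inverseʳ (seq y n)))))
  (ℚ.<⇒≤ ε>0)

p≤p+ε : ∀ p {ε} → 0ℚ ℚ.< ε → p ℚ.≤ p ℚ.+ ε
p≤p+ε p {ε} ε>0 = subst (ℚ._≤ p ℚ.+ ε) (ℚ.+-identityʳ p) (ℚ.+-monoʳ-≤ p (ℚ.<⇒≤ ε>0))

pointwise-≤ : ∀ x y → (∀ n → seq x n ℚ.≤ seq y n) → x ≤ʳ y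
pointwise-≤ x y le ε ε>0 = always λ n → ℚ.≤-trans (le n) (p≤p+ε (seq y n) ε>0)

≈⇒≤ : ∀ x y → x ≈ y → x ≤ʳ y
≈⇒≤ x y x≈y ε ε>0 = let N , p = x≈y ε ε>0 in
  N , λ n le → ∣p-q∣≤⇒p≤q+ (seq x n) (seq y n) (p n le)

≤-refl : ∀ x → x ≤ʳ x
≤-refl x = ≈⇒≤ x x (≈-refl x)

≤-antisym : ∀ x y → x ≤ʳ y → y ≤ʳ x → x ≈ y
≤-antisym x y x≤y y≤x ε ε>0 =
  eventually₂ (λ n → ≤+⇒∣-∣≤ (seq x n) (seq y n)) (x≤y ε ε>0) (y≤x ε ε>0)

≤-trans : ∀ x y z → x ≤ʳ y → y ≤ʳ z → x ≤ʳ z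
≤-trans x y z x≤y y≤z ε ε>0 = eventually₂
  (λ n p q → subst (seq x n ℚ.≤_)
    (≡.trans (ℚ.+-assoc (seq z n) _ _) (cong (seq z n ℚ.+_) (½ε+½ε≡ε ε)))
    (ℚ.≤-trans p (ℚ.+-monoˡ-≤ (½ ℚ.* ε) q)))
  (x≤y (½ ℚ.* ε) (½ε>0 ε>0)) (y≤z (½ ℚ.* ε) (½ε>0 ε>0))

≤-resp-≈ : ∀ x x′ y y′ → x ≈ x′ → y ≈ y′ → x ≤ʳ y → x′ ≤ʳ y′
≤-resp-≈ x x′ y y′ x≈x′ y≈y′ x≤y =
  ≤-trans x′ x y′ (≈⇒≤ x′ x (≈-sym x x′ x≈x′)) (≤-trans x y y′ x≤y (≈⇒≤ y y′ y≈y′))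

+-mono-≤ : ∀ x y u v → x ≤ʳ y → u ≤ʳ v → x + u ≤ʳ y + v
+-mono-≤ x y u v x≤y u≤v ε ε>0 = eventually₂
  (λ n p q → subst (seq x n ℚ.+ seq u n ℚ.≤_)
    (≡.trans
      (solve 4 (λ y v δ δ′ → (y :+ δ) :+ (v :+ δ′) := (y :+ v) :+ (δ :+ δ′)) ≡.refl
        (seq y n) (seq v n) (½ ℚ.* ε) (½ ℚ.* ε))
      (cong (seq y n ℚ.+ seq v n ℚ.+_) (½ε+½ε≡ε ε)))
    (ℚ.+-mono-≤ p q))
  (x≤y (½ ℚ.* ε) (½ε>0 ε>0)) (u≤v (½ ℚ.* ε) (½ε>0 ε>0))

+-cong : ∀ x y u v → x ≈ y → u ≈ v → x + u ≈ y + v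
+-cong x y u v x≈y u≈v = ≤-antisym (x + u) (y + v)
  (+-mono-≤ x y u v (≈⇒≤ x y x≈y) (≈⇒≤ u v u≈v))
  (+-mono-≤ y x v u (≈⇒≤ y x (≈-sym x y x≈y)) (≈⇒≤ v u (≈-sym u v u≈v)))

bounded : ∀ x → Σ[ B ∈ ℚ ] 0ℚ ℚ.< B × Eventually λ n → ∣ seq x n ∣ ℚ.≤ B
bounded x =
  let N , p = cauchy x 1ℚ (ℚ.positive⁻¹ 1ℚ)
      a     = seq x N
  in  1ℚ ℚ.+ ∣ a ∣ , ℚ.+-mono-<-≤ (ℚ.positive⁻¹ 1ℚ) (ℚ.0≤∣p∣ a) , N , λ n N≤n →
        ℚ.≤-trans
          (subst (λ s → ∣ s ∣ ℚ.≤ ∣ seq x n ℚ.- a ∣ ℚ.+ ∣ a ∣)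
            (solve 2 (λ b a → (b :+ :- a) :+ a := b) ≡.refl (seq x n) a)
            (ℚ.∣p+q∣≤∣p∣+∣q∣ (seq x n ℚ.- a) a))
          (ℚ.+-monoˡ-≤ ∣ a ∣ (p n N N≤n ℕ.≤-refl))

÷-positive : ∀ {B ε} → 0ℚ ℚ.< B → 0ℚ ℚ.< ε → Σ[ δ ∈ ℚ ] 0ℚ ℚ.< δ × B ℚ.* δ ≡ ε
÷-positive {B} {ε} B>0 ε>0 = B⁻¹ ℚ.* ε , δ>0 , Bδ≡ε
  where
  instance
    B-positive : ℚ.Positive B
    B-positive = ℚ.positive B>0

    B-nonZero : ℚ.NonZero B
    B-nonZero = ℚ.pos⇒nonZero B

  B⁻¹ : ℚ
  B⁻¹ = ℚ.1/ B

  δ>0 : 0ℚ ℚ.< B⁻¹ ℚ.* ε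
  δ>0 = subst (ℚ._< B⁻¹ ℚ.* ε) (ℚ.*-zeroʳ B⁻¹) (ℚ.*-monoʳ-<-pos B⁻¹ {{ℚ.1/pos⇒pos B}} ε>0)

  Bδ≡ε : B ℚ.* (B⁻¹ ℚ.* ε) ≡ ε
  Bδ≡ε = ≡.trans (≡.sym (ℚ.*-assoc B B⁻¹ ε))
    (≡.trans (cong (ℚ._* ε) (ℚ.*-inverseʳ B)) (ℚ.*-identityˡ ε))

*-congˡ : ∀ c x y → x ≈ y → c * x ≈ c * y
*-congˡ c x y x≈y ε ε>0 =
  let B , B>0 , c≤B = bounded c
      δ , δ>0 , Bδ≡ε = ÷-positive B>0 ε>0
  in  eventually₂ (λ n → bound (seq c n) (seq x n) (seq y n) B>0 Bδ≡ε) c≤B (x≈y δ δ>0)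
  where
  bound : ∀ c x y {B δ} → 0ℚ ℚ.< B → B ℚ.* δ ≡ ε →
          ∣ c ∣ ℚ.≤ B → ∣ x ℚ.- y ∣ ℚ.≤ δ → ∣ c ℚ.* x ℚ.- c ℚ.* y ∣ ℚ.≤ ε
  bound c x y {B} {δ} B>0 Bδ≡ε ∣c∣≤B ∣x-y∣≤δ = subst₂ ℚ._≤_
    (≡.trans (≡.sym (ℚ.∣p*q∣≡∣p∣*∣q∣ c (x ℚ.- y)))
      (cong ∣_∣ (solve 3 (λ c x y → c :* (x :+ :- y) := c :* x :+ :- (c :* y)) ≡.refl c x y)))
    Bδ≡ε
    (ℚ.≤-trans
      (ℚ.*-monoʳ-≤-nonNeg ∣ x ℚ.- y ∣ {{ℚ.nonNegative (ℚ.0≤∣p∣ (x ℚ.- y))}} ∣c∣≤B)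
      (ℚ.*-monoˡ-≤-nonNeg B {{ℚ.nonNegative (ℚ.<⇒≤ B>0)}} ∣x-y∣≤δ))

*-comm : ∀ x y → x * y ≈ y * x
*-comm x y = pointwise-≈ (x * y) (y * x) λ n → ℚ.*-comm (seq x n) (seq y n)

*-cong : ∀ x y u v → x ≈ y → u ≈ v → x * u ≈ y * v
*-cong x y u v x≈y u≈v =
  ≈-trans (x * u) (x * v) (y * v) (*-congˡ x u v u≈v)
    (≈-trans (x * v) (v * x) (y * v) (*-comm x v)
      (≈-trans (v * x) (v * y) (y * v) (*-congˡ v x y x≈y) (*-comm v y)))

abs : ℝ → ℝ
abs x = mkℝ (λ n → ∣ seq x n ∣) λ ε ε>0 → let N , p = cauchy x ε ε>0 in
  N , λ m n N≤m N≤n → ≤+⇒∣-∣≤ ∣ seq x m ∣ ∣ seq x n ∣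
    (∣p∣≤∣q∣+ (seq x m) (seq x n) (p m n N≤m N≤n)) (∣p∣≤∣q∣+ (seq x n) (seq x m) (p n m N≤n N≤m))
  where
  ∣p∣≤∣q∣+ : ∀ p q {ε} → ∣ p ℚ.- q ∣ ℚ.≤ ε → ∣ p ∣ ℚ.≤ ∣ q ∣ ℚ.+ ε
  ∣p∣≤∣q∣+ p q ∣p-q∣≤ε = ℚ.≤-trans
    (subst (λ s → ∣ s ∣ ℚ.≤ ∣ q ∣ ℚ.+ ∣ p ℚ.- q ∣)
      (solve 2 (λ p q → q :+ (p :+ :- q) := p) ≡.refl p q) (ℚ.∣p+q∣≤∣p∣+∣q∣ q (p ℚ.- q)))
    (ℚ.+-monoʳ-≤ ∣ q ∣ ∣p-q∣≤ε)

≥0⇒≈abs : ∀ x → 0ℝ ≤ʳ x → x ≈ abs x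
≥0⇒≈abs x 0≤x ε ε>0 = let N , p = 0≤x (½ ℚ.* ε) (½ε>0 ε>0) in
  N , λ n le → bound (seq x n) (p n le)
  where
  bound : ∀ p → 0ℚ ℚ.≤ p ℚ.+ ½ ℚ.* ε → ∣ p ℚ.- ∣ p ∣ ∣ ℚ.≤ ε
  bound p 0≤p+ with ℚ.∣p∣≡p∨∣p∣≡-p p
  ... | inj₁ eq rewrite eq | ℚ.+-inverseʳ p = ℚ.<⇒≤ ε>0
  -- For negative p, twice 0 ≤ p + ε/2 gives - p ≤ p + ε.
  ... | inj₂ eq = ≤+⇒∣-∣≤ p ∣ p ∣
    (ℚ.≤-trans (p≤∣p∣ p) (p≤p+ε ∣ p ∣ ε>0))
    (subst₂ ℚ._≤_
      (≡.trans (solve 1 (λ p → con 0ℚ :+ :- p := :- p) ≡.refl p) (≡.sym eq))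
      (≡.trans (solve 2 (λ p δ → ((p :+ δ) :+ (p :+ δ)) :+ :- p := p :+ (δ :+ δ)) ≡.refl p (½ ℚ.* ε))
        (cong (p ℚ.+_) (½ε+½ε≡ε ε)))
      (ℚ.+-monoˡ-≤ (ℚ.- p) (ℚ.+-mono-≤ 0≤p+ 0≤p+)))

-- A nonnegative real may have slightly negative terms, so its sequence says nothing termwise.
-- Replacing the factors by their absolute values makes every term of the product nonnegative.
*-nonneg : ∀ x y → 0ℝ ≤ʳ x → 0ℝ ≤ʳ y → 0ℝ ≤ʳ x * y
*-nonneg x y 0≤x 0≤y = ≤-resp-≈ 0ℝ 0ℝ (abs x * abs y) (x * y) (≈-refl 0ℝ)
  (≈-sym (x * y) (abs x * abs y) (*-cong x (abs x) y (abs y) (≥0⇒≈abs x 0≤x) (≥0⇒≈abs y 0≤y)))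
  (pointwise-≤ 0ℝ (abs x * abs y) λ n →
    subst (0ℚ ℚ.≤_) (ℚ.∣p*q∣≡∣p∣*∣q∣ (seq x n) (seq y n)) (ℚ.0≤∣p∣ _))

infixl 6 _-_

_-_ : ℝ → ℝ → ℝ
x - y = x + fromℚ (ℚ.- 1ℚ) * y

x≤y⇒0≤y-x : ∀ x y → x ≤ʳ y → 0ℝ ≤ʳ y - x
x≤y⇒0≤y-x x y x≤y = ≤-resp-≈ (x - x) 0ℝ (y - x) (y - x)
  (pointwise-≈ (x - x) 0ℝ λ n → solve 1 (λ x → x :+ con (ℚ.- 1ℚ) :* x := con 0ℚ) ≡.refl (seq x n))
  (≈-refl (y - x))
  (+-mono-≤ x y (fromℚ (ℚ.- 1ℚ) * x) (fromℚ (ℚ.- 1ℚ) * x) x≤y (≤-refl (fromℚ (ℚ.- 1ℚ) * x)))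

*-monoˡ-≤ : ∀ c x y → 0ℝ ≤ʳ c → x ≤ʳ y → c * x ≤ʳ c * y
*-monoˡ-≤ c x y 0≤c x≤y = ≤-resp-≈ (0ℝ + c * x) (c * x) (c * (y - x) + c * x) (c * y)
  (pointwise-≈ (0ℝ + c * x) (c * x) λ n → ℚ.+-identityˡ (seq c n ℚ.* seq x n))
  (pointwise-≈ (c * (y - x) + c * x) (c * y) λ n →
    solve 3 (λ c x y → c :* (y :+ con (ℚ.- 1ℚ) :* x) :+ c :* x := c :* y) ≡.refl
      (seq c n) (seq x n) (seq y n))
  (+-mono-≤ 0ℝ (c * (y - x)) (c * x) (c * x) (*-nonneg c (y - x) 0≤c (x≤y⇒0≤y-x x y x≤y)) (≤-refl (c * x)))

-- The order of ℚ is decidable, so q < p may be assumed; the tolerance (p - q)/2 then contradicts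
-- it. Through this lemma real inequalities return to ℤ and ℕ.
fromℚ-cancel-≤ : ∀ p q → fromℚ p ≤ʳ fromℚ q → p ℚ.≤ q
fromℚ-cancel-≤ p q p≤q with p ℚ.≤? q
... | yes le = le
... | no p≰q = contradiction p≤q′ p≰q
  where
  q<p : q ℚ.< p
  q<p = ℚ.≰⇒> p≰q

  d : ℚ
  d = p ℚ.- q

  d>0 : 0ℚ ℚ.< d
  d>0 = subst (ℚ._< d) (ℚ.+-inverseʳ q) (ℚ.+-monoˡ-< (ℚ.- q) q<p)

  p≤q+½d : p ℚ.≤ q ℚ.+ ½ ℚ.* d
  p≤q+½d = let N , h = p≤q (½ ℚ.* d) (½ε>0 d>0) in h N ℕ.≤-refl

  p≤q′ : p ℚ.≤ q
  p≤q′ = subst₂ ℚ._≤_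
    (solve 2 (λ p q → (p :+ p) :+ :- p := p) ≡.refl p q)
    (≡.trans (solve 3 (λ p q h → ((q :+ h) :+ (q :+ h)) :+ :- p := (q :+ (q :+ :- p)) :+ (h :+ h))
        ≡.refl p q (½ ℚ.* d))
      (≡.trans (cong (q ℚ.+ (q ℚ.- p) ℚ.+_) (½ε+½ε≡ε d))
        (solve 2 (λ p q → (q :+ (q :+ :- p)) :+ (p :+ :- q) := q) ≡.refl p q)))
    (ℚ.+-monoˡ-≤ (ℚ.- p) (ℚ.+-mono-≤ p≤q+½d p≤q+½d))

-- Normalisation by a gcd blocks computation with a variable z. In the unnormalised rationals the
-- fraction is the bare pair of z and 1, where the laws below reduce to laws of ℤ.
z/1 : ∀ z → ℚ.toℚᵘ (z ℚ./ 1) ℚᵘ.≃ mkℚᵘ z 0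
z/1 z = ℚ.toℚᵘ-fromℚᵘ (mkℚᵘ z 0)

/1-homo-+ : ∀ a b → (a ℤ.+ b) ℚ./ 1 ≡ a ℚ./ 1 ℚ.+ b ℚ./ 1
/1-homo-+ a b = ℚ.toℚᵘ-injective (ℚᵘ.≃-trans (z/1 (a ℤ.+ b))
  (ℚᵘ.≃-trans (*≡* (cong (ℤ._* (+ 1)) (≡.sym (cong₂ ℤ._+_ (ℤ.*-identityʳ a) (ℤ.*-identityʳ b)))))
    (ℚᵘ.≃-trans (ℚᵘ.+-cong (ℚᵘ.≃-sym (z/1 a)) (ℚᵘ.≃-sym (z/1 b)))
      (ℚᵘ.≃-sym (ℚ.toℚᵘ-homo-+ (a ℚ./ 1) (b ℚ./ 1))))))

/1-homo-* : ∀ a b → (a ℤ.* b) ℚ./ 1 ≡ a ℚ./ 1 ℚ.* (b ℚ./ 1)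
/1-homo-* a b = ℚ.toℚᵘ-injective (ℚᵘ.≃-trans (z/1 (a ℤ.* b))
  (ℚᵘ.≃-trans (*≡* ≡.refl)
    (ℚᵘ.≃-trans (ℚᵘ.*-cong (ℚᵘ.≃-sym (z/1 a)) (ℚᵘ.≃-sym (z/1 b)))
      (ℚᵘ.≃-sym (ℚ.toℚᵘ-homo-* (a ℚ./ 1) (b ℚ./ 1))))))

/1-mono-≤ : ∀ {a b} → a ℤ.≤ b → a ℚ./ 1 ℚ.≤ b ℚ./ 1
/1-mono-≤ {a} {b} a≤b = ℚ.toℚᵘ-cancel-≤
  (ℚᵘ.≤-respˡ-≃ (ℚᵘ.≃-sym (z/1 a)) (ℚᵘ.≤-respʳ-≃ (ℚᵘ.≃-sym (z/1 b)) 
    (*≤* (subst₂ ℤ._≤_ (≡.sym (ℤ.*-identityʳ a)) (≡.sym (ℤ.*-identityʳ b)) a≤b))))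

/1-cancel-≤ : ∀ {a b} → a ℚ./ 1 ℚ.≤ b ℚ./ 1 → a ℤ.≤ b
/1-cancel-≤ {a} {b} a≤b = subst₂ ℤ._≤_ (ℤ.*-identityʳ a) (ℤ.*-identityʳ b) (ℚᵘ.drop-*≤*
  (ℚᵘ.≤-respˡ-≃ (z/1 a) (ℚᵘ.≤-respʳ-≃ (z/1 b) (ℚ.toℚᵘ-mono-≤ a≤b))))

fromℤ-homo-+ : ∀ a b → fromℤ (a ℤ.+ b) ≈ fromℤ a + fromℤ b
fromℤ-homo-+ a b = pointwise-≈ (fromℤ (a ℤ.+ b)) (fromℤ a + fromℤ b) λ _ → /1-homo-+ a b

fromℤ-homo-* : ∀ a b → fromℤ (a ℤ.* b) ≈ fromℤ a * fromℤ b
fromℤ-homo-* a b = pointwise-≈ (fromℤ (a ℤ.* b)) (fromℤ a * fromℤ b) λ _ → /1-homo-* a b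

fromℤ-cancel-≤ : ∀ a b → fromℤ a ≤ʳ fromℤ b → a ℤ.≤ b
fromℤ-cancel-≤ a b a≤b = /1-cancel-≤ (fromℚ-cancel-≤ (a ℚ./ 1) (b ℚ./ 1) a≤b)

fromℕ-homo-+ : ∀ a b → fromℕℝ (a ℕ.+ b) ≈ fromℕℝ a + fromℕℝ b
fromℕ-homo-+ a b = fromℤ-homo-+ (+ a) (+ b)

fromℕ-homo-* : ∀ a b → fromℕℝ (a ℕ.* b) ≈ fromℕℝ a * fromℕℝ b
fromℕ-homo-* a b = subst (λ c → fromℤ c ≈ fromℕℝ a * fromℕℝ b) (≡.sym (ℤ.pos-* a b))
    (fromℤ-homo-* (+ a) (+ b))

fromℕ-mono-≤ : ∀ {a b} → a ℕ.≤ b → fromℕℝ a ≤ʳ fromℕℝ b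
fromℕ-mono-≤ {a} {b} a≤b = pointwise-≤ (fromℕℝ a) (fromℕℝ b) λ _ → /1-mono-≤ (ℤ.+≤+ a≤b)

fromℕ-cancel-≤ : ∀ a b → fromℕℝ a ≤ʳ fromℕℝ b → a ℕ.≤ b
fromℕ-cancel-≤ a b a≤b = ℤ.drop‿+≤+ (fromℤ-cancel-≤ (+ a) (+ b) a≤b)

fromℕ-injective : ∀ a b → fromℕℝ a ≈ fromℕℝ b → a ≡ b
fromℕ-injective a b a≈b = ℕ.≤-antisym
  (fromℕ-cancel-≤ a b (≈⇒≤ (fromℕℝ a) (fromℕℝ b) a≈b))
  (fromℕ-cancel-≤ b a (≈⇒≤ (fromℕℝ b) (fromℕℝ a) (≈-sym (fromℕℝ a) (fromℕℝ b) a≈b)))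

-- The signs of x and y cannot be decided, but their terms at one late index M can be compared with
-- δ = ε/2. One of the two is at least δ, and the Cauchy condition with tolerance η = ε/4 keeps its
-- later terms above η.
0<+⇒0<⊎0< : ∀ x y → 0ℝ < x + y → 0ℝ < x ⊎ 0ℝ < y
0<+⇒0<⊎0< x y (ε , ε>0 , N , x+y≥ε) = case
  where
  δ = ½ ℚ.* ε
  η = ½ ℚ.* δ
  η>0 = ½ε>0 (½ε>0 ε>0)
  A = proj₁ (cauchy x η η>0)
  B = proj₁ (cauchy y η η>0)
  M = N ℕ.⊔ (A ℕ.⊔ B)

  A≤M : A ℕ.≤ M
  A≤M = ℕ.≤-trans (ℕ.m≤m⊔n A B) (ℕ.m≤n⊔m N (A ℕ.⊔ B))

  B≤M : B ℕ.≤ M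
  B≤M = ℕ.≤-trans (ℕ.m≤n⊔m A B) (ℕ.m≤n⊔m N (A ℕ.⊔ B))

  δ+δ≤ : δ ℚ.+ δ ℚ.≤ seq x M ℚ.+ seq y M
  δ+δ≤ = subst (ℚ._≤ seq x M ℚ.+ seq y M) (≡.trans (ℚ.+-identityˡ ε) (≡.sym (½ε+½ε≡ε ε)))
    (x+y≥ε M (ℕ.m≤m⊔n N (A ℕ.⊔ B)))

  eventually≥η : ∀ z → (∀ n → proj₁ (cauchy z η η>0) ℕ.≤ n → ∣ seq z M ℚ.- seq z n ∣ ℚ.≤ η) →
                 δ ℚ.≤ seq z M → 0ℝ < z
  eventually≥η z close δ≤z = η , η>0 , proj₁ (cauchy z η η>0) , λ n le →
    subst₂ ℚ._≤_
      (≡.trans (cong (ℚ._- η) (≡.sym (½ε+½ε≡ε δ)))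
        (solve 1 (λ h → (h :+ h) :+ :- h := con 0ℚ :+ h) ≡.refl η))
      (solve 2 (λ z h → (z :+ h) :+ :- h := z) ≡.refl (seq z n) η)
      (ℚ.+-monoˡ-≤ (ℚ.- η) (ℚ.≤-trans δ≤z (∣p-q∣≤⇒p≤q+ (seq z M) (seq z n) (close n le))))

  case : 0ℝ < x ⊎ 0ℝ < y
  case with δ ℚ.≤? seq x M | δ ℚ.≤? seq y M
  ... | yes δ≤x | _ = inj₁ (eventually≥η x (λ n le → proj₂ (cauchy x η η>0) M n A≤M le) δ≤x)
  ... | no _ | yes δ≤y = inj₂ (eventually≥η y (λ n le → proj₂ (cauchy y η η>0) M n B≤M le) δ≤y)
  ... | no δ≰x | no δ≰y = contradiction (ℚ.<-≤-trans (ℚ.+-mono-< (ℚ.≰⇒> δ≰x) (ℚ.≰⇒> δ≰y)) δ+δ≤)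
      (ℚ.<-irrefl ≡.refl)

-- Linear combinations and convex hulls

sum-cong : ∀ {m} (f g : Vector ℝ m) → f ≋ g → sum f ≈ sum g
sum-cong {zero}  f g f≋g = ≈-refl 0ℝ
sum-cong {suc m} f g f≋g = +-cong (f zero) (g zero) (sum (f ∘ suc)) (sum (g ∘ suc))
  (f≋g zero) (sum-cong (f ∘ suc) (g ∘ suc) (f≋g ∘ suc))

module _ {n} {C : Pred ℝ 0ℓ} {S : Subset n} where

  -- Induction on the number of summands. Invariants of cones and closure properties of combinations
  -- are both obtained as instances.
  combination-rec : (Q : Subset n) →
    (∀ x y → x ≋ y → Q y → Q x) →
    Q (λ _ → 0ℝ) →
    (∀ c y x → C c → S y → Q x → Q (λ j → c * y j + x j)) →
    ∀ x → LinearCombinations C S x → Q x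
  combination-rec Q resp nil cons x (m , c , y , c∈C , y∈S , x≋) =
    resp x (linearCombination c y) x≋ (go m c y c∈C y∈S)
    where
    go : ∀ m (c : Vector ℝ m) (y : Vector (Vector ℝ n) m) →
         (∀ i → C (c i)) → (∀ i → S (y i)) → Q (linearCombination c y)
    go zero    c y c∈C y∈S = nil
    go (suc m) c y c∈C y∈S =
      resp (linearCombination c y) (λ j → c zero * y zero j + linearCombination (c ∘ suc) (y ∘ suc) j)
        (λ j → pointwise-≈ (linearCombination c y j)
          (c zero * y zero j + linearCombination (c ∘ suc) (y ∘ suc) j) λ _ → ≡.refl)
        (cons (c zero) (y zero) (linearCombination (c ∘ suc) (y ∘ suc)) (c∈C zero) (y∈S zero)
          (go m (c ∘ suc) (y ∘ suc) (c∈C ∘ suc) (y∈S ∘ suc)))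

  combination-resp : ∀ x y → x ≋ y → LinearCombinations C S y → LinearCombinations C S x
  combination-resp x y x≋y (m , c , u , c∈C , u∈S , y≋) =
    m , c , u , c∈C , u∈S , λ j → ≈-trans (x j) (y j) (linearCombination c u j) (x≋y j) (y≋ j)

  combination-0 : LinearCombinations C S (λ _ → 0ℝ)
  combination-0 = 0 , (λ ()) , (λ ()) , (λ ()) , (λ ()) , λ j → ≈-refl 0ℝ

  combination-∷ : ∀ c y x → C c → S y → LinearCombinations C S x →
                  LinearCombinations C S (λ j → c * y j + x j)
  combination-∷ c y x c∈C y∈S (m , d , u , d∈C , u∈S , x≋) =
    suc m , c ∷ d , y ∷ u ,
    (λ { zero → c∈C ; (suc i) → d∈C i }) ,
    (λ { zero → y∈S ; (suc i) → u∈S i }) ,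
    λ j → ≈-trans (c * y j + x j) (c * y j + linearCombination d u j) (linearCombination (c ∷ d) (y ∷ u) j)
      (+-cong (c * y j) (c * y j) (x j) (linearCombination d u j) (≈-refl (c * y j)) (x≋ j))
      (+-cong (c * y j) (c * y j) (linearCombination d u j) (sum λ i → (c ∷ d) (suc i) * (y ∷ u) (suc i) j)
        (≈-refl (c * y j))
        (sum-cong (λ i → d i * u i j) (λ i → (c ∷ d) (suc i) * (y ∷ u) (suc i) j) λ i →
          pointwise-≈ (d i * u i j) ((c ∷ d) (suc i) * (y ∷ u) (suc i) j) λ _ → ≡.refl))

  combination-+ : ∀ x y → LinearCombinations C S x → LinearCombinations C S y →
                  LinearCombinations C S (λ j → x j + y j)
  combination-+ x y x∈ y∈ = combination-rec (λ x → LinearCombinations C S (λ j → x j + y j))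
    (λ u v u≋v → combination-resp (λ j → u j + y j) (λ j → v j + y j) λ j →
      +-cong (u j) (v j) (y j) (y j) (u≋v j) (≈-refl (y j)))
    (combination-resp (λ j → 0ℝ + y j) y
      (λ j → pointwise-≈ (0ℝ + y j) (y j) λ k → ℚ.+-identityˡ (seq (y j) k)) y∈)
    (λ c u v c∈C u∈S v+y∈ →
      combination-resp (λ j → (c * u j + v j) + y j) (λ j → c * u j + (v j + y j))
        (λ j → pointwise-≈ ((c * u j + v j) + y j) (c * u j + (v j + y j)) λ k →
          ℚ.+-assoc (seq c k ℚ.* seq (u j) k) (seq (v j) k) (seq (y j) k))
        (combination-∷ c u (λ j → v j + y j) c∈C u∈S v+y∈))
    x x∈

  combination-scale : ∀ a → (∀ c → C c → C (a * c)) → ∀ x →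
                      LinearCombinations C S x → LinearCombinations C S (λ j → a * x j)
  combination-scale a aC⊆C = combination-rec (λ x → LinearCombinations C S (λ j → a * x j))
    (λ u v u≋v → combination-resp (λ j → a * u j) (λ j → a * v j) λ j → *-congˡ a (u j) (v j) (u≋v j))
    (combination-resp (λ _ → a * 0ℝ) (λ _ → 0ℝ)
      (λ j → pointwise-≈ (a * 0ℝ) 0ℝ λ k → ℚ.*-zeroʳ (seq a k)) combination-0)
    (λ c u v c∈C u∈S av∈ →
      combination-resp (λ j → a * (c * u j + v j)) (λ j → (a * c) * u j + a * v j)
        (λ j → pointwise-≈ (a * (c * u j + v j)) ((a * c) * u j + a * v j) λ k →
          solve 4 (λ a c u v → a :* (c :* u :+ v) := (a :* c) :* u :+ a :* v) ≡.refl
            (seq a k) (seq c k) (seq (u j) k) (seq (v j) k))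
        (combination-∷ (a * c) u (λ j → a * v j) (aC⊆C c c∈C) u∈S av∈))

  generator∈combinations : C 1ℝ → ∀ y → S y → LinearCombinations C S y
  generator∈combinations 1∈C y y∈S = combination-resp y (λ j → 1ℝ * y j + 0ℝ)
    (λ j → pointwise-≈ (y j) (1ℝ * y j + 0ℝ) λ k →
      ≡.sym (≡.trans (ℚ.+-identityʳ _) (ℚ.*-identityˡ (seq (y j) k))))
    (combination-∷ 1ℝ y (λ _ → 0ℝ) 1∈C y∈S combination-0)

combination-mono : ∀ {n} {C D : Pred ℝ 0ℓ} {S : Subset n} → (∀ c → C c → D c) →
                   ∀ x → LinearCombinations C S x → LinearCombinations D S x
combination-mono C⊆D x (m , c , y , c∈C , y∈S , x≋) = m , c , y , (λ i → C⊆D (c i) (c∈C i)) , y∈S , x≋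

generator∈affineCombinations : ∀ {n} {C : Pred ℝ 0ℓ} {S : Subset n} → C 1ℝ → ∀ y → S y
    → AffineCombinations C S y
generator∈affineCombinations 1∈C y y∈S =
  1 , (λ _ → 1ℝ) , (λ _ → y) , (λ _ → 1∈C) ,
  pointwise-≈ (1ℝ + 0ℝ) 1ℝ (λ _ → ≡.refl) , (λ _ → y∈S) ,
  λ j → pointwise-≈ (y j) (1ℝ * y j + 0ℝ) λ k →
    ≡.sym (≡.trans (ℚ.+-identityʳ _) (ℚ.*-identityˡ (seq (y j) k)))

affine⇒linear : ∀ {n} {C : Pred ℝ 0ℓ} {S : Subset n} x → AffineCombinations C S x → LinearCombinations C S x
affine⇒linear x (m , c , y , c∈C , _ , y∈S , x≋) = m , c , y , c∈C , y∈S , x≋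

sum-≗ : ∀ {m} (f g : Vector ℝ m) → (∀ i k → seq (f i) k ≡ seq (g i) k) → sum f ≈ sum g
sum-≗ f g eq = sum-cong f g λ i → pointwise-≈ (f i) (g i) (eq i)

sum-*1 : ∀ {m} (c : Vector ℝ m) → sum (λ i → c i * 1ℝ) ≈ sum c
sum-*1 c = sum-cong (λ i → c i * 1ℝ) c λ i → pointwise-≈ (c i * 1ℝ) (c i) λ k → ℚ.*-identityʳ (seq (c i) k)

-- In the inserted coordinate the combination is the sum of the weights, which is 1.
insertAt-linearCombination : ∀ {m n} (c : Vector ℝ m) (y : Vector (Vector ℝ n) m) (x : Vector ℝ n) i →
  sum c ≈ 1ℝ → x ≋ linearCombination c y →
  insertAt x i 1ℝ ≋ linearCombination c (λ k → insertAt (y k) i 1ℝ)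
insertAt-linearCombination c y x zero ∑c≈1 x≋ zero =
  ≈-sym (sum (λ k → c k * insertAt (y k) zero 1ℝ zero)) 1ℝ
    (≈-trans (sum (λ k → c k * insertAt (y k) zero 1ℝ zero)) (sum (λ k → c k * 1ℝ)) 1ℝ
      (sum-≗ (λ k → c k * insertAt (y k) zero 1ℝ zero) (λ k → c k * 1ℝ) λ _ _ → ≡.refl)
      (≈-trans (sum (λ k → c k * 1ℝ)) (sum c) 1ℝ (sum-*1 c) ∑c≈1))
insertAt-linearCombination c y x zero ∑c≈1 x≋ (suc j) =
  ≈-trans (x j) (linearCombination c y j) (sum (λ k → c k * insertAt (y k) zero 1ℝ (suc j))) (x≋ j)
    (sum-≗ (λ k → c k * y k j) (λ k → c k * insertAt (y k) zero 1ℝ (suc j)) λ _ _ → ≡.refl)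
insertAt-linearCombination {n = suc n} c y x (suc i) ∑c≈1 x≋ zero =
  ≈-trans (x zero) (linearCombination c y zero) (sum (λ k → c k * insertAt (y k) (suc i) 1ℝ zero)) (x≋ zero)
    (sum-≗ (λ k → c k * y k zero) (λ k → c k * insertAt (y k) (suc i) 1ℝ zero) λ _ _ → ≡.refl)
insertAt-linearCombination {n = suc n} c y x (suc i) ∑c≈1 x≋ (suc j) =
  ≈-trans (insertAt (x ∘ suc) i 1ℝ j) (sum (λ k → c k * insertAt (y k ∘ suc) i 1ℝ j))
    (sum (λ k → c k * insertAt (y k) (suc i) 1ℝ (suc j)))
    (insertAt-linearCombination c (λ k → y k ∘ suc) (x ∘ suc) i ∑c≈1
      (λ j → ≈-trans (x (suc j)) (linearCombination c y (suc j)) (linearCombination c (λ k → y k ∘ suc) j)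
          (x≋ (suc j))
        (sum-≗ (λ k → c k * y k (suc j)) (λ k → c k * y k (suc j)) λ _ _ → ≡.refl)) j)
    (sum-≗ (λ k → c k * insertAt (y k ∘ suc) i 1ℝ j)
        (λ k → c k * insertAt (y k) (suc i) 1ℝ (suc j)) λ _ _ → ≡.refl)

AtHeightOne : ∀ {n} → Subset n → Subset (suc n)
AtHeightOne S w = ∃[ α ] α ∈ S × w ≋ atHeightOne α

homogenize : ∀ {n} {C : Pred ℝ 0ℓ} {S : Subset n} x →
             AffineCombinations C S x → LinearCombinations C (AtHeightOne S) (atHeightOne x)
homogenize {n} x (m , c , y , c∈C , ∑c≈1 , y∈S , x≋) =
  m , c , (λ k → atHeightOne (y k)) , c∈C ,
  (λ k → y k , y∈S k , λ j → ≈-refl (atHeightOne (y k) j)) ,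
  λ j → ≈-trans (atHeightOne x j) (sum λ k → c k * insertAt (y k) (fromℕ n) 1ℝ j)
      (sum λ k → c k * atHeightOne (y k) j)
    (insertAt-linearCombination c y x (fromℕ n) ∑c≈1 x≋ j)
    (sum-≗ (λ k → c k * insertAt (y k) (fromℕ n) 1ℝ j) (λ k → c k * atHeightOne (y k) j) λ _ _ → ≡.refl)

homogenization-height : ∀ {n} (P : Subset n) x → Homogenization P x → x (fromℕ n) ≈ 1ℝ
homogenization-height {n} P x (m , c , y , _ , ∑c≈1 , y∈ , x≋) =
  ≈-trans (x l) (sum (λ i → c i * y i l)) 1ℝ (x≋ l)
    (≈-trans (sum (λ i → c i * y i l)) (sum (λ i → c i * 1ℝ)) 1ℝ
      (sum-cong (λ i → c i * y i l) (λ i → c i * 1ℝ) λ i → *-congˡ (c i) (y i l) 1ℝ (height i))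
      (≈-trans (sum (λ i → c i * 1ℝ)) (sum c) 1ℝ (sum-*1 c) ∑c≈1))
  where
  l = fromℕ n
  height : ∀ i → y i l ≈ 1ℝ
  height i = let α , _ , y≋ = y∈ i in
    subst (y i l ≈_) (insertAt-lookup α l 1ℝ) (y≋ l)

𝒜⇒ℝ≥0𝒜 : ∀ {n} (P : Subset n) x → 𝒜 P x → ℝ≥0𝒜 P x
𝒜⇒ℝ≥0𝒜 P = generator∈combinations {C = Nonnegative} {S = 𝒜 P} (fromℕ-mono-≤ {0} {1} ℕ.z≤n)

ℤ𝒜⇒integer : ∀ {n} (P : Subset n) x → ℤ𝒜 P x → ℤ^ (suc n) x
ℤ𝒜⇒integer P = combination-rec {C = Integer} {S = 𝒜 P} (ℤ^ _)
  (λ x y x≋y y∈ j → let z , y≈ = y∈ j in z , ≈-trans (x j) (y j) (fromℤ z) (x≋y j) y≈)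
  (λ j → + 0 , ≈-refl 0ℝ)
  (λ c y x (d , c≈) y∈ x∈ j →
    let a , y≈ = proj₂ y∈ j
        b , x≈ = x∈ j
    in  d ℤ.* a ℤ.+ b ,
        ≈-trans (c * y j + x j) (fromℤ d * fromℤ a + fromℤ b) (fromℤ (d ℤ.* a ℤ.+ b))
          (+-cong (c * y j) (fromℤ d * fromℤ a) (x j) (fromℤ b)
            (*-cong c (fromℤ d) (y j) (fromℤ a) c≈ y≈) x≈)
          (≈-sym (fromℤ (d ℤ.* a ℤ.+ b)) (fromℤ d * fromℤ a + fromℤ b)
            (≈-trans (fromℤ (d ℤ.* a ℤ.+ b)) (fromℤ (d ℤ.* a) + fromℤ b) (fromℤ d * fromℤ a + fromℤ b)
              (fromℤ-homo-+ (d ℤ.* a) b)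
              (+-cong (fromℤ (d ℤ.* a)) (fromℤ d * fromℤ a) (fromℤ b) (fromℤ b)
                (fromℤ-homo-* d a) (≈-refl (fromℤ b))))))

ι : ∀ {n} → Vector ℕ n → Vector ℝ n
ι V j = fromℕℝ (V j)

nonneg-integer⇒natural : ∀ {n} (w : Vector ℝ n) → ℤ^ n w → (∀ j → 0ℝ ≤ʳ w j) → ∃[ V ] w ≋ ι V
nonneg-integer⇒natural w w∈ℤ 0≤w = (λ j → ℤ.∣ proj₁ (w∈ℤ j) ∣) , λ j →
  let z , w≈z = w∈ℤ j
      +∣z∣≡z  = ℤ.0≤i⇒+∣i∣≡i (fromℤ-cancel-≤ (+ 0) z
                  (≤-resp-≈ 0ℝ 0ℝ (w j) (fromℤ z) (≈-refl 0ℝ) w≈z (0≤w j)))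
  in  ≈-trans (w j) (fromℤ z) (fromℤ (+ ℤ.∣ z ∣)) w≈z
        (pointwise-≈ (fromℤ z) (fromℤ (+ ℤ.∣ z ∣)) λ _ → cong (ℚ._/ 1) (≡.sym +∣z∣≡z))

-- Linear forms

infixl 6 _⊕_
infixl 7 _⊙_

-- Syntax gives each inequality two readings: over ℕ, where it is checked at the generators and used
-- at lattice points, and over ℝ, where it spreads through the cone. Coefficients are natural, so a
-- negative term is written on the other side of `_⊑_`.
data Form (n : ℕ) : Set where
  var  : Fin n → Form n
  _⊕_  : Form n → Form n → Form n
  _⊙_  : ℕ → Form n → Form n
  ∑    : ∀ {m} → (Fin m → Form n) → Form n

⟦_⟧ : ∀ {n} → Form n → Vector ℝ n → ℝ
⟦ var j ⟧ w = w j
⟦ f ⊕ g ⟧ w = ⟦ f ⟧ w + ⟦ g ⟧ w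
⟦ k ⊙ f ⟧ w = fromℕℝ k * ⟦ f ⟧ w
⟦ ∑ f ⟧   w = sum λ i → ⟦ f i ⟧ w

⟦_⟧ℕ : ∀ {n} → Form n → Vector ℕ n → ℕ
⟦ var j ⟧ℕ V = V j
⟦ f ⊕ g ⟧ℕ V = ⟦ f ⟧ℕ V ℕ.+ ⟦ g ⟧ℕ V
⟦ k ⊙ f ⟧ℕ V = k ℕ.* ⟦ f ⟧ℕ V
⟦ ∑ f ⟧ℕ   V = ℕΣ.sum λ i → ⟦ f i ⟧ℕ V

⟦_⟧-cong : ∀ {n} (f : Form n) v w → v ≋ w → ⟦ f ⟧ v ≈ ⟦ f ⟧ w
⟦ var j ⟧-cong v w v≋w = v≋w j
⟦ f ⊕ g ⟧-cong v w v≋w = +-cong (⟦ f ⟧ v) (⟦ f ⟧ w) (⟦ g ⟧ v) (⟦ g ⟧ w) (⟦ f ⟧-cong v w v≋w)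
    (⟦ g ⟧-cong v w v≋w)
⟦ k ⊙ f ⟧-cong v w v≋w = *-congˡ (fromℕℝ k) (⟦ f ⟧ v) (⟦ f ⟧ w) (⟦ f ⟧-cong v w v≋w)
⟦ ∑ f ⟧-cong   v w v≋w = sum-cong (λ i → ⟦ f i ⟧ v) (λ i → ⟦ f i ⟧ w) λ i → ⟦ f i ⟧-cong v w v≋w

sum-∷-linear : ∀ {m} c (f g h : Vector ℝ m) → (∀ k i → seq (h i) k ≡ seq c k ℚ.* seq (f i) k ℚ.+ seq
    (g i) k) →
               ∀ k → seq (sum h) k ≡ seq c k ℚ.* seq (sum f) k ℚ.+ seq (sum g) k
sum-∷-linear {zero}  c f g h eq k = solve 1 (λ c → con 0ℚ := c :* con 0ℚ :+ con 0ℚ) ≡.refl (seq c k)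
sum-∷-linear {suc m} c f g h eq k = ≡.trans
  (cong₂ ℚ._+_ (eq k zero) (sum-∷-linear c (f ∘ suc) (g ∘ suc) (h ∘ suc) (λ k i → eq k (suc i)) k))
  (solve 5 (λ c a b a′ b′ → (c :* a :+ b) :+ (c :* a′ :+ b′) := c :* (a :+ a′) :+ (b :+ b′)) ≡.refl
    (seq c k) (seq (f zero) k) (seq (g zero) k) (seq (sum (f ∘ suc)) k) (seq (sum (g ∘ suc)) k))

⟦_⟧-linear : ∀ {n} (f : Form n) c v w k →
  seq (⟦ f ⟧ λ j → c * v j + w j) k ≡ seq c k ℚ.* seq (⟦ f ⟧ v) k ℚ.+ seq (⟦ f ⟧ w) k
⟦ var j ⟧-linear c v w k = ≡.refl
⟦ f ⊕ g ⟧-linear c v w k = ≡.trans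
  (cong₂ ℚ._+_ (⟦ f ⟧-linear c v w k) (⟦ g ⟧-linear c v w k))
  (solve 5 (λ c a b a′ b′ → (c :* a :+ b) :+ (c :* a′ :+ b′) := c :* (a :+ a′) :+ (b :+ b′)) ≡.refl
    (seq c k) (seq (⟦ f ⟧ v) k) (seq (⟦ f ⟧ w) k) (seq (⟦ g ⟧ v) k) (seq (⟦ g ⟧ w) k))
⟦ d ⊙ f ⟧-linear c v w k = ≡.trans
  (cong (seq (fromℕℝ d) k ℚ.*_) (⟦ f ⟧-linear c v w k))
  (solve 4 (λ d c a b → d :* (c :* a :+ b) := c :* (d :* a) :+ d :* b) ≡.refl
    (seq (fromℕℝ d) k) (seq c k) (seq (⟦ f ⟧ v) k) (seq (⟦ f ⟧ w) k))
⟦ ∑ f ⟧-linear   c v w k = sum-∷-linear c (λ i → ⟦ f i ⟧ v) (λ i → ⟦ f i ⟧ w)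
    (λ i → ⟦ f i ⟧ λ j → c * v j + w j)
  (λ k i → ⟦ f i ⟧-linear c v w k) k

sum-fromℕ : ∀ {m} (f : Vector ℝ m) (g : Vector ℕ m) → (∀ i → f i ≈ fromℕℝ (g i)) → sum f ≈ fromℕℝ (ℕΣ.sum g)
sum-fromℕ {zero}  f g f≈g = ≈-refl 0ℝ
sum-fromℕ {suc m} f g f≈g =
  ≈-trans (f zero + sum (f ∘ suc)) (fromℕℝ (g zero) + fromℕℝ (ℕΣ.sum (g ∘ suc))) (fromℕℝ (ℕΣ.sum g))
    (+-cong (f zero) (fromℕℝ (g zero)) (sum (f ∘ suc)) (fromℕℝ (ℕΣ.sum (g ∘ suc)))
      (f≈g zero) (sum-fromℕ (f ∘ suc) (g ∘ suc) (f≈g ∘ suc)))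
    (≈-sym (fromℕℝ (ℕΣ.sum g)) (fromℕℝ (g zero) + fromℕℝ (ℕΣ.sum (g ∘ suc)))
        (fromℕ-homo-+ (g zero) (ℕΣ.sum (g ∘ suc))))

⟦_⟧-ι : ∀ {n} (f : Form n) V → ⟦ f ⟧ (ι V) ≈ fromℕℝ (⟦ f ⟧ℕ V)
⟦ var j ⟧-ι V = ≈-refl (fromℕℝ (V j))
⟦ f ⊕ g ⟧-ι V = ≈-trans (⟦ f ⟧ (ι V) + ⟦ g ⟧ (ι V)) (fromℕℝ (⟦ f ⟧ℕ V) + fromℕℝ (⟦ g ⟧ℕ V))
    (fromℕℝ (⟦ f ⊕ g ⟧ℕ V))
  (+-cong (⟦ f ⟧ (ι V)) (fromℕℝ (⟦ f ⟧ℕ V)) (⟦ g ⟧ (ι V)) (fromℕℝ (⟦ g ⟧ℕ V)) (⟦ f ⟧-ι V) (⟦ g ⟧-ι V))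
  (≈-sym (fromℕℝ (⟦ f ⊕ g ⟧ℕ V)) (fromℕℝ (⟦ f ⟧ℕ V) + fromℕℝ (⟦ g ⟧ℕ V))
      (fromℕ-homo-+ (⟦ f ⟧ℕ V) (⟦ g ⟧ℕ V)))
⟦ k ⊙ f ⟧-ι V = ≈-trans (fromℕℝ k * ⟦ f ⟧ (ι V)) (fromℕℝ k * fromℕℝ (⟦ f ⟧ℕ V)) (fromℕℝ (⟦ k ⊙ f ⟧ℕ V))
  (*-congˡ (fromℕℝ k) (⟦ f ⟧ (ι V)) (fromℕℝ (⟦ f ⟧ℕ V)) (⟦ f ⟧-ι V))
  (≈-sym (fromℕℝ (⟦ k ⊙ f ⟧ℕ V)) (fromℕℝ k * fromℕℝ (⟦ f ⟧ℕ V)) (fromℕ-homo-* k (⟦ f ⟧ℕ V)))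
⟦ ∑ f ⟧-ι   V = sum-fromℕ (λ i → ⟦ f i ⟧ (ι V)) (λ i → ⟦ f i ⟧ℕ V) λ i → ⟦ f i ⟧-ι V

sum-0 : ∀ {m} (f : Vector ℝ m) k → (∀ i → seq (f i) k ≡ 0ℚ) → seq (sum f) k ≡ 0ℚ
sum-0 {zero}  f k f≡0 = ≡.refl
sum-0 {suc m} f k f≡0 = cong₂ ℚ._+_ (f≡0 zero) (sum-0 (f ∘ suc) k (f≡0 ∘ suc))

⟦_⟧-0 : ∀ {n} (f : Form n) k → seq (⟦ f ⟧ λ _ → 0ℝ) k ≡ 0ℚ
⟦ var j ⟧-0 k = ≡.refl
⟦ f ⊕ g ⟧-0 k = cong₂ ℚ._+_ (⟦ f ⟧-0 k) (⟦ g ⟧-0 k)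
⟦ d ⊙ f ⟧-0 k = ≡.trans (cong (seq (fromℕℝ d) k ℚ.*_) (⟦ f ⟧-0 k)) (ℚ.*-zeroʳ (seq (fromℕℝ d) k))
⟦ ∑ f ⟧-0   k = sum-0 (λ i → ⟦ f i ⟧ λ _ → 0ℝ) k λ i → ⟦ f i ⟧-0 k

infix 4 _⊑_

_⊑_ : ∀ {n} → Form n → Form n → Subset n
(f ⊑ g) w = ⟦ f ⟧ w ≤ʳ ⟦ g ⟧ w

⊑-resp : ∀ {n} (f g : Form n) x y → x ≋ y → (f ⊑ g) y → (f ⊑ g) x
⊑-resp f g x y x≋y = ≤-resp-≈ (⟦ f ⟧ y) (⟦ f ⟧ x) (⟦ g ⟧ y) (⟦ g ⟧ x)
  (≈-sym (⟦ f ⟧ x) (⟦ f ⟧ y) (⟦ f ⟧-cong x y x≋y)) (≈-sym (⟦ g ⟧ x) (⟦ g ⟧ y) (⟦ g ⟧-cong x y x≋y))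

⊑-ι : ∀ {n} (f g : Form n) V → ⟦ f ⟧ℕ V ℕ.≤ ⟦ g ⟧ℕ V → (f ⊑ g) (ι V)
⊑-ι f g V le = ≤-resp-≈ (fromℕℝ (⟦ f ⟧ℕ V)) (⟦ f ⟧ (ι V)) (fromℕℝ (⟦ g ⟧ℕ V)) (⟦ g ⟧ (ι V))
  (≈-sym (⟦ f ⟧ (ι V)) (fromℕℝ (⟦ f ⟧ℕ V)) (⟦ f ⟧-ι V))
      (≈-sym (⟦ g ⟧ (ι V)) (fromℕℝ (⟦ g ⟧ℕ V)) (⟦ g ⟧-ι V))
  (fromℕ-mono-≤ le)

⊑-ι⁻¹ : ∀ {n} (f g : Form n) V → (f ⊑ g) (ι V) → ⟦ f ⟧ℕ V ℕ.≤ ⟦ g ⟧ℕ V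
⊑-ι⁻¹ f g V le = fromℕ-cancel-≤ (⟦ f ⟧ℕ V) (⟦ g ⟧ℕ V)
  (≤-resp-≈ (⟦ f ⟧ (ι V)) (fromℕℝ (⟦ f ⟧ℕ V)) (⟦ g ⟧ (ι V)) (fromℕℝ (⟦ g ⟧ℕ V)) (⟦ f ⟧-ι V) (⟦ g ⟧-ι V) le)

-- The inequality cuts out a half-space with the origin on its boundary, and this is a convex cone.
⊑-cone : ∀ {n} {S : Subset n} (f g : Form n) → (∀ y → S y → (f ⊑ g) y) →
         ∀ x → LinearCombinations Nonnegative S x → (f ⊑ g) x
⊑-cone {S = S} f g S⊑ = combination-rec {C = Nonnegative} {S = S} (f ⊑ g) (⊑-resp f g)
  (pointwise-≤ (⟦ f ⟧ λ _ → 0ℝ) (⟦ g ⟧ λ _ → 0ℝ) λ k →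
    ℚ.≤-reflexive (≡.trans (⟦ f ⟧-0 k) (≡.sym (⟦ g ⟧-0 k))))
  (λ c y x 0≤c y∈S fx≤gx → ≤-resp-≈
    (c * ⟦ f ⟧ y + ⟦ f ⟧ x) (⟦ f ⟧ λ j → c * y j + x j)
    (c * ⟦ g ⟧ y + ⟦ g ⟧ x) (⟦ g ⟧ λ j → c * y j + x j)
    (pointwise-≈ (c * ⟦ f ⟧ y + ⟦ f ⟧ x) (⟦ f ⟧ λ j → c * y j + x j) λ k → ≡.sym (⟦ f ⟧-linear c y x k))
    (pointwise-≈ (c * ⟦ g ⟧ y + ⟦ g ⟧ x) (⟦ g ⟧ λ j → c * y j + x j) λ k → ≡.sym (⟦ g ⟧-linear c y x k))
    (+-mono-≤ (c * ⟦ f ⟧ y) (c * ⟦ g ⟧ y) (⟦ f ⟧ x) (⟦ g ⟧ x)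
      (*-monoˡ-≤ c (⟦ f ⟧ y) (⟦ g ⟧ y) 0≤c (S⊑ y y∈S)) fx≤gx))

⊑-hull : ∀ {n} {S : Subset n} (f g : Form (suc n)) → (∀ y → S y → (f ⊑ g) (atHeightOne y)) →
         ∀ x → ConvexHull S x → (f ⊑ g) (atHeightOne x)
⊑-hull {S = S} f g S⊑ x x∈ = ⊑-cone {S = AtHeightOne S} f g
  (λ w (α , α∈S , w≋) → ⊑-resp f g w (atHeightOne α) w≋ (S⊑ α α∈S)) (atHeightOne x)
      (homogenize {C = Nonnegative} {S = S} x x∈)

-- Three layers of combinations are crossed: the hull of S, the hull of its points moved to height
-- one, and the cone over the lattice points of the latter.
⊑-ℝ≥0𝒜 : ∀ {n} {S : Subset n} (f g : Form (suc n)) → (∀ y → S y → (f ⊑ g) (atHeightOne y)) →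
          ∀ x → ℝ≥0𝒜 (ConvexHull S) x → (f ⊑ g) x
⊑-ℝ≥0𝒜 {S = S} f g S⊑ = ⊑-cone {S = 𝒜 (ConvexHull S)} f g λ y (y∈ , _) →
  ⊑-cone {S = AtHeightOne (ConvexHull S)} f g (λ w (α , α∈ , w≋) → ⊑-resp f g w (atHeightOne α) w≋
      (⊑-hull f g S⊑ α α∈))
    y (affine⇒linear {C = Nonnegative} {S = AtHeightOne (ConvexHull S)} y y∈)

-- Vertices of a convex hull

positive-summand : ∀ {m} (c : Vector ℝ m) → 0ℝ < sum c → ∃[ i ] 0ℝ < c i
positive-summand {zero} c (ε , ε>0 , N , p) =
  contradiction (ℚ.<-≤-trans ε>0 (subst (ℚ._≤ 0ℚ) (ℚ.+-identityˡ ε) (p N ℕ.≤-refl))) (ℚ.<-irrefl ≡.refl)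
positive-summand {suc m} c (ε , ε>0 , N , p) =
  [ (λ 0<c₀ → zero , 0<c₀) , (λ 0<∑ → let i , 0<cᵢ = positive-summand (c ∘ suc) 0<∑ in suc i , 0<cᵢ) ]′
    (0<+⇒0<⊎0< (c zero) (sum (c ∘ suc)) (ε , ε>0 , N , p))

≈1⇒0< : ∀ x → x ≈ 1ℝ → 0ℝ < x
≈1⇒0< x x≈1 = let N , p = ≈⇒≤ 1ℝ x (≈-sym x 1ℝ x≈1) ½ (ℚ.positive⁻¹ ½) in
  ½ , ℚ.positive⁻¹ ½ , N , λ n le → subst (½ ℚ.≤_)
    (solve 1 (λ x → (x :+ con ½) :+ con (ℚ.- ½) := x) ≡.refl (seq x n)) (ℚ.+-monoˡ-≤ (ℚ.- ½) (p n le))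

decrease : ∀ {m} → Vector ℝ m → Fin m → ℚ → Vector ℝ m
decrease c i s = updateAt c i (_+ fromℚ (ℚ.- s))

-- Moves a real sum, term by term, into ℚ, where the semiring lemmas for sums and the ring solver
-- apply.
seq-sum : ∀ {m} (f : Vector ℝ m) k → seq (sum f) k ≡ ℚΣ.sum (λ i → seq (f i) k)
seq-sum {zero}  f k = ≡.refl
seq-sum {suc m} f k = cong (seq (f zero) k ℚ.+_) (seq-sum (f ∘ suc) k)

seq-decrease : ∀ {m} (c : Vector ℝ m) i s l k →
  seq (decrease c i s l) k ≡ updateAt (λ l → seq (c l) k) i (ℚ._- s) l
seq-decrease {suc m} c zero    s zero    k = ≡.refl
seq-decrease {suc m} c zero    s (suc l) k = ≡.refl
seq-decrease {suc m} c (suc i) s zero    k = ≡.refl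
seq-decrease {suc m} c (suc i) s (suc l) k = seq-decrease (c ∘ suc) i s l k

sum-updateAt : ∀ {m} (c w : Vector ℚ m) i s →
  ℚΣ.sum (λ l → c l ℚ.* w l) ≡ s ℚ.* w i ℚ.+ ℚΣ.sum (λ l → updateAt c i (ℚ._- s) l ℚ.* w l)
sum-updateAt {suc m} c w zero s =
  solve 4 (λ c w s r → c :* w :+ r := s :* w :+ ((c :+ :- s) :* w :+ r)) ≡.refl
    (c zero) (w zero) s (ℚΣ.sum λ l → c (suc l) ℚ.* w (suc l))
sum-updateAt {suc m} c w (suc i) s = ≡.trans
  (cong (c zero ℚ.* w zero ℚ.+_) (sum-updateAt (c ∘ suc) (w ∘ suc) i s))
  (solve 3 (λ a b r → a :+ (b :+ r) := b :+ (a :+ r)) ≡.refl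
    (c zero ℚ.* w zero) (s ℚ.* w (suc i)) (ℚΣ.sum λ l → updateAt (c ∘ suc) i (ℚ._- s) l ℚ.* w (suc l)))

sum-decrease : ∀ {m} (c w : Vector ℝ m) i s k →
  seq (sum λ l → c l * w l) k ≡ s ℚ.* seq (w i) k ℚ.+ seq (sum λ l → decrease c i s l * w l) k
sum-decrease c w i s k = begin
  seq (sum λ l → c l * w l) k
    ≡⟨ seq-sum (λ l → c l * w l) k ⟩
  ℚΣ.sum (λ l → seq (c l) k ℚ.* seq (w l) k)
    ≡⟨ sum-updateAt (λ l → seq (c l) k) (λ l → seq (w l) k) i s ⟩
  s ℚ.* seq (w i) k ℚ.+ ℚΣ.sum (λ l → updateAt (λ l → seq (c l) k) i (ℚ._- s) l ℚ.* seq (w l) k)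
    ≡⟨ cong (s ℚ.* seq (w i) k ℚ.+_) (ℚΣ.sum-cong-≗ λ l → cong (ℚ._* seq (w l) k)
        (seq-decrease c i s l k)) ⟨
  s ℚ.* seq (w i) k ℚ.+ ℚΣ.sum (λ l → seq (decrease c i s l) k ℚ.* seq (w l) k)
    ≡⟨ cong (s ℚ.* seq (w i) k ℚ.+_) (seq-sum (λ l → decrease c i s l * w l) k) ⟨
  s ℚ.* seq (w i) k ℚ.+ seq (sum λ l → decrease c i s l * w l) k ∎
  where open ≡.≡-Reasoning

decrease-nonneg : ∀ {m} (c : Vector ℝ m) i s → fromℚ s ≤ʳ c i → (∀ l → 0ℝ ≤ʳ c l)
    → ∀ l → 0ℝ ≤ʳ decrease c i s l
decrease-nonneg {suc m} c zero    s s≤c 0≤c zero    = ≤-resp-≈ (fromℚ s + fromℚ (ℚ.- s)) 0ℝ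
    (c zero + fromℚ (ℚ.- s)) (c zero + fromℚ (ℚ.- s))
  (pointwise-≈ (fromℚ s + fromℚ (ℚ.- s)) 0ℝ λ _ → ℚ.+-inverseʳ s) (≈-refl (c zero + fromℚ (ℚ.- s)))
  (+-mono-≤ (fromℚ s) (c zero) (fromℚ (ℚ.- s)) (fromℚ (ℚ.- s)) s≤c (≤-refl (fromℚ (ℚ.- s))))
decrease-nonneg {suc m} c zero    s s≤c 0≤c (suc l) = 0≤c (suc l)
decrease-nonneg {suc m} c (suc i) s s≤c 0≤c zero    = 0≤c zero
decrease-nonneg {suc m} c (suc i) s s≤c 0≤c (suc l) = decrease-nonneg (c ∘ suc) i s s≤c (0≤c ∘ suc) l

sum-scale : ∀ {m} r (c w : Vector ℝ m) k →
  seq (sum λ l → (fromℚ r * c l) * w l) k ≡ r ℚ.* seq (sum λ l → c l * w l) k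
sum-scale r c w k = begin
  seq (sum λ l → (fromℚ r * c l) * w l) k
    ≡⟨ seq-sum (λ l → (fromℚ r * c l) * w l) k ⟩
  ℚΣ.sum (λ l → (r ℚ.* seq (c l) k) ℚ.* seq (w l) k)
    ≡⟨ ℚΣ.sum-cong-≗ (λ l → ℚ.*-assoc r (seq (c l) k) (seq (w l) k)) ⟩
  ℚΣ.sum (λ l → r ℚ.* (seq (c l) k ℚ.* seq (w l) k))
    ≡⟨ ℚΣ.*-distribˡ-sum r (λ l → seq (c l) k ℚ.* seq (w l) k) ⟨
  r ℚ.* ℚΣ.sum (λ l → seq (c l) k ℚ.* seq (w l) k)
    ≡⟨ cong (r ℚ.*_) (seq-sum (λ l → c l * w l) k) ⟨
  r ℚ.* seq (sum λ l → c l * w l) k ∎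
  where open ≡.≡-Reasoning

-- A part s of the weight x that can be split off, with r = 1 / (1 - s) to renormalise the rest.
-- Taking s rational makes this reciprocal available; the cap at ½ in `fraction` keeps 1 - s
-- positive even if the weight is 1.
record Fraction (x : ℝ) : Set where
  field
    s r   : ℚ
    s>0   : 0ℚ ℚ.< s
    1-s>0 : 0ℚ ℚ.< 1ℚ ℚ.- s
    r>0   : 0ℚ ℚ.< r
    tr≡1  : (1ℚ ℚ.- s) ℚ.* r ≡ 1ℚ
    s≤x   : fromℚ s ≤ʳ x

fraction : ∀ x → 0ℝ < x → Fraction x
fraction x (q , q>0 , N , q≤x) = record
  { s     = q ℚ.⊓ ½
  ; r     = proj₁ reciprocal
  ; s>0   = s>0
  ; 1-s>0 = t>0
  ; r>0   = proj₁ (proj₂ reciprocal)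
  ; tr≡1  = proj₂ (proj₂ reciprocal)
  ; s≤x   = λ ε ε>0 → N , λ n le → ℚ.≤-trans (ℚ.p⊓q≤p q ½)
      (ℚ.≤-trans (subst (ℚ._≤ seq x n) (ℚ.+-identityˡ q) (q≤x n le)) (p≤p+ε (seq x n) ε>0))
  }
  where
  s>0 : 0ℚ ℚ.< q ℚ.⊓ ½
  s>0 with ℚ.≤-total q ½
  ... | inj₁ q≤½ = subst (0ℚ ℚ.<_) (≡.sym (ℚ.p≤q⇒p⊓q≡p q≤½)) q>0
  ... | inj₂ ½≤q = subst (0ℚ ℚ.<_) (≡.sym (ℚ.p≥q⇒p⊓q≡q ½≤q)) (ℚ.positive⁻¹ ½)

  t>0 : 0ℚ ℚ.< 1ℚ ℚ.- (q ℚ.⊓ ½)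
  t>0 = ℚ.<-≤-trans (ℚ.positive⁻¹ ½) (ℚ.+-monoʳ-≤ 1ℚ (ℚ.neg-antimono-≤ (ℚ.p⊓q≤q q ½)))

  reciprocal : Σ[ r ∈ ℚ ] 0ℚ ℚ.< r × (1ℚ ℚ.- (q ℚ.⊓ ½)) ℚ.* r ≡ 1ℚ
  reciprocal = ÷-positive t>0 (ℚ.positive⁻¹ 1ℚ)

module _ {m} (c : Vector ℝ m) (i : Fin m) (s r : ℚ) (tr≡1 : (1ℚ ℚ.- s) ℚ.* r ≡ 1ℚ) where

  sum-rescaled : sum c ≈ 1ℝ → sum (λ l → fromℚ r * decrease c i s l) ≈ 1ℝ
  sum-rescaled ∑c≈1 = begin
    sum (λ l → fromℚ r * decrease c i s l)
      ≈⟨ sum-*1 (λ l → fromℚ r * decrease c i s l) ⟨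
    sum (λ l → (fromℚ r * decrease c i s l) * 1ℝ)
      ≈⟨ pointwise-≈ (sum λ l → (fromℚ r * decrease c i s l) * 1ℝ)
           (fromℚ r * (sum (λ l → c l * 1ℝ) + fromℚ (ℚ.- s))) scale-decrease ⟩
    fromℚ r * (sum (λ l → c l * 1ℝ) + fromℚ (ℚ.- s))
      ≈⟨ *-congˡ (fromℚ r) (sum (λ l → c l * 1ℝ) + fromℚ (ℚ.- s)) (1ℝ + fromℚ (ℚ.- s))
           (+-cong (sum λ l → c l * 1ℝ) 1ℝ (fromℚ (ℚ.- s)) (fromℚ (ℚ.- s))
             (≈-trans (sum λ l → c l * 1ℝ) (sum c) 1ℝ (sum-*1 c) ∑c≈1) (≈-refl (fromℚ (ℚ.- s)))) ⟩
    fromℚ r * (1ℝ + fromℚ (ℚ.- s))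
      ≈⟨ pointwise-≈ (fromℚ r * (1ℝ + fromℚ (ℚ.- s))) 1ℝ (λ _ → ≡.trans (ℚ.*-comm r (1ℚ ℚ.- s)) tr≡1) ⟩
    1ℝ ∎
    where
    open SetoidReasoning ≈-setoid

    scale-decrease : ∀ k → seq (sum λ l → (fromℚ r * decrease c i s l) * 1ℝ) k ≡
                           r ℚ.* (seq (sum λ l → c l * 1ℝ) k ℚ.- s)
    scale-decrease k = ≡.trans (sum-scale r (decrease c i s) (λ _ → 1ℝ) k) (cong (r ℚ.*_)
      (≡.trans
        (solve 2 (λ s u → u := (s :* con 1ℚ :+ u) :+ :- s)
            ≡.refl s (seq (sum λ l → decrease c i s l * 1ℝ) k))
        (cong (ℚ._- s) (≡.sym (sum-decrease c (λ _ → 1ℝ) i s k)))))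

  split-combination : ∀ (w : Vector ℝ m) → sum (λ l → c l * w l) ≈
    fromℚ s * w i + fromℚ (1ℚ ℚ.- s) * sum (λ l → (fromℚ r * decrease c i s l) * w l)
  split-combination w = pointwise-≈ (sum λ l → c l * w l)
    (fromℚ s * w i + fromℚ (1ℚ ℚ.- s) * sum (λ l → (fromℚ r * decrease c i s l) * w l)) λ k →
    let u = seq (sum λ l → decrease c i s l * w l) k in
    ≡.trans (sum-decrease c w i s k) (cong (s ℚ.* seq (w i) k ℚ.+_)
      (≡.trans (≡.sym (ℚ.*-identityˡ u))
        (≡.trans (cong (ℚ._* u) (≡.sym tr≡1))
          (≡.trans (ℚ.*-assoc (1ℚ ℚ.- s) r u)
            (cong ((1ℚ ℚ.- s) ℚ.*_) (≡.sym (sum-scale r (decrease c i s) w k)))))))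

s*y+t*y≈y : ∀ s y → fromℚ s * y + fromℚ (1ℚ ℚ.- s) * y ≈ y
s*y+t*y≈y s y = pointwise-≈ (fromℚ s * y + fromℚ (1ℚ ℚ.- s) * y) y λ k →
  solve 2 (λ s y → s :* y :+ (con 1ℚ :+ :- s) :* y := y) ≡.refl s (seq y k)

0<fromℚ : ∀ p → 0ℚ ℚ.< p → 0ℝ < fromℚ p
0<fromℚ p p>0 = p , p>0 , always λ _ → ℚ.≤-reflexive (ℚ.+-identityˡ p)

-- A weight cᵢ > 0 in x = Σ cᵢ yᵢ lets x be written as s yᵢ + (1 - s) z with 0 < s < 1 and z in the hull.
vertex∈generators : ∀ {n} {S : Subset n} x → Vertex (ConvexHull S) x → ∃[ y ] y ∈ S × x ≋ y
vertex∈generators {n} {S} x ((m , c , y , 0≤c , ∑c≈1 , y∈S , x≋) , extreme) =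
  let i , 0<cᵢ = positive-summand c (≈1⇒0< (sum c) ∑c≈1) in
  y i , y∈S i , x≋yᵢ i (fraction (c i) 0<cᵢ)
  where
  module _ (i : Fin m) (f : Fraction (c i)) where
    open Fraction f

    t : ℚ
    t = 1ℚ ℚ.- s

    z : Vector ℝ n
    z = linearCombination (λ l → fromℚ r * decrease c i s l) y

    z∈ : ConvexHull S z
    z∈ = m , (λ l → fromℚ r * decrease c i s l) , y ,
      (λ l → *-nonneg (fromℚ r) (decrease c i s l) (pointwise-≤ 0ℝ (fromℚ r) λ _ → ℚ.<⇒≤ r>0)
        (decrease-nonneg c i s s≤x 0≤c l)) ,
      sum-rescaled c i s r tr≡1 ∑c≈1 , y∈S , λ j → ≈-refl (z j)

    x≋s*yᵢ+t*z : x ≋ (λ j → fromℚ s * y i j + fromℚ t * z j)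
    x≋s*yᵢ+t*z j = ≈-trans (x j) (linearCombination c y j) (fromℚ s * y i j + fromℚ t * z j) (x≋ j)
      (split-combination c i s r tr≡1 (λ l → y l j))

    yᵢ≋z : y i ≋ z
    yᵢ≋z = extreme (y i) z (fromℚ s) (fromℚ t)
      (generator∈affineCombinations {C = Nonnegative} {S = S} (fromℕ-mono-≤ {0} {1} ℕ.z≤n) (y i) (y∈S i)) z∈
      (0<fromℚ s s>0) (0<fromℚ t 1-s>0)
      (pointwise-≈ (fromℚ s + fromℚ t) 1ℝ λ _ → solve 1 (λ s → s :+ (con 1ℚ :+ :- s) := con 1ℚ) ≡.refl s)
      x≋s*yᵢ+t*z

    x≋yᵢ : x ≋ y i
    x≋yᵢ j = begin
      x j                                ≈⟨ x≋s*yᵢ+t*z j ⟩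
      fromℚ s * y i j + fromℚ t * z j
        ≈⟨ +-cong (fromℚ s * y i j) (fromℚ s * y i j) (fromℚ t * z j) (fromℚ t * y i j)
             (≈-refl (fromℚ s * y i j)) (*-congˡ (fromℚ t) (z j) (y i j) (≈-sym (y i j) (z j) (yᵢ≋z j))) ⟩
      fromℚ s * y i j + fromℚ t * y i j  ≈⟨ s*y+t*y≈y s (y i j) ⟩
      y i j                              ∎
      where open SetoidReasoning ≈-setoid

-- The polytope

ι-cong : ∀ {n} {V W : Vector ℕ n} → V ≗ W → ι V ≋ ι W
ι-cong {V = V} {W} V≗W j = pointwise-≈ (fromℕℝ (V j)) (fromℕℝ (W j)) λ _ → cong (λ n → + n ℚ./ 1) (V≗W j)

insertAt-ι : ∀ {n} (x : Vector ℝ n) (V : Vector ℕ n) i → x ≋ ι V → insertAt x i 1ℝ ≋ ι (insertAt V i 1)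
insertAt-ι x V zero x≋V zero = pointwise-≈ 1ℝ (fromℕℝ 1) λ _ → ≡.refl
insertAt-ι x V zero x≋V (suc j) = x≋V j
insertAt-ι {suc n} x V (suc i) x≋V zero = x≋V zero
insertAt-ι {suc n} x V (suc i) x≋V (suc j) = insertAt-ι (x ∘ suc) (V ∘ suc) i (x≋V ∘ suc) j

natural⇒nonneg : ∀ c → Natural c → Nonnegative c
natural⇒nonneg c (n , c≈n) = ≤-resp-≈ 0ℝ 0ℝ (fromℕℝ n) c (≈-refl 0ℝ) (≈-sym c (fromℕℝ n) c≈n)
  (fromℕ-mono-≤ {0} {n} z≤n)

natural⇒integer : ∀ c → Natural c → Integer c
natural⇒integer c (n , c≈n) = + n , c≈n

≋-sym : ∀ {n} (x y : Vector ℝ n) → x ≋ y → y ≋ x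
≋-sym x y x≋y j = ≈-sym (x j) (y j) (x≋y j)

≋-trans : ∀ {n} (x y z : Vector ℝ n) → x ≋ y → y ≋ z → x ≋ z
≋-trans x y z x≋y y≋z j = ≈-trans (x j) (y j) (z j) (x≋y j) (y≋z j)

½*2*p≡p : ∀ p → ½ ℚ.* ((+ 2 ℚ./ 1) ℚ.* p) ≡ p
½*2*p≡p p = ≡.trans (≡.sym (ℚ.*-assoc ½ (+ 2 ℚ./ 1) p)) (ℚ.*-identityˡ p)

sum-*0ℚ : ∀ {m} (u : Vector ℚ m) → ℚΣ.sum (λ i → u i ℚ.* 0ℚ) ≡ 0ℚ
sum-*0ℚ {zero}  u = ≡.refl
sum-*0ℚ {suc m} u = cong₂ ℚ._+_ (ℚ.*-zeroʳ (u zero)) (sum-*0ℚ (u ∘ suc))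

sum-*-unitℚ : ∀ {m} (u : Vector ℚ m) j → ℚΣ.sum (λ i → u i ℚ.* (+ unit i j ℚ./ 1)) ≡ u j
sum-*-unitℚ u zero = ≡.trans (cong₂ ℚ._+_ (ℚ.*-identityʳ (u zero)) (sum-*0ℚ (u ∘ suc)))
    (ℚ.+-identityʳ (u zero))
sum-*-unitℚ u (suc j) = ≡.trans (cong₂ ℚ._+_ (ℚ.*-zeroʳ (u zero)) (sum-*-unitℚ (u ∘ suc) j))
    (ℚ.+-identityˡ (u (suc j)))

module Polytope (h m : ℕ) where

  open Combinatorics h m

  -- With every lattice point of the segments in the list, each `G b j` with j ≤ h belongs to `𝒜 P`
  -- without any computation of convex weights.
  vertices : Vector (Vector ℝ (5 ℕ.+ m)) ((4 ℕ.+ m) ℕ.* suc h)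
  vertices k = let b , j = remQuot {4 ℕ.+ m} (suc h) k in ι (generator b (toℕ j))

  P : Subset (5 ℕ.+ m)
  P = ConvexHull (Range vertices)

  generator∈Range : ∀ b j → j ℕ.≤ h → Range vertices (ι (generator b j))
  generator∈Range b j j≤h = combine b (fromℕ< (s≤s j≤h)) , ι-cong λ l →
    ≡.trans (cong (λ i → generator b i l) (≡.sym (Fin.toℕ-fromℕ< (s≤s j≤h))))
      (cong (λ (b , i) → generator b (toℕ i) l) (≡.sym (Fin.remQuot-combine b (fromℕ< (s≤s j≤h)))))

  Range⇒generator : ∀ y → Range vertices y → ∃[ b ] ∃[ j ] j ℕ.≤ h × y ≋ ι (generator b j)
  Range⇒generator y (k , y≋) = proj₁ (remQuot {4 ℕ.+ m} (suc h) k) , toℕ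
      (proj₂ (remQuot {4 ℕ.+ m} (suc h) k)) ,
    ℕ.s≤s⁻¹ (Fin.toℕ<n (proj₂ (remQuot {4 ℕ.+ m} (suc h) k))) , y≋

  generator∈P : ∀ b j → j ℕ.≤ h → P (ι (generator b j))
  generator∈P b j j≤h = generator∈affineCombinations {C = Nonnegative} {S = Range vertices}
    (fromℕ-mono-≤ {0} {1} z≤n) (ι (generator b j)) (generator∈Range b j j≤h)

  G∈𝒜 : ∀ b j → j ℕ.≤ h → 𝒜 P (ι (G b j))
  G∈𝒜 b j j≤h = generator∈affineCombinations {C = Nonnegative} {S = AtHeightOne P}
      (fromℕ-mono-≤ {0} {1} z≤n) (ι (G b j))
      (ι (generator b j) , generator∈P b j j≤h ,
        ≋-sym (atHeightOne (ι (generator b j))) (ι (G b j))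
          (insertAt-ι (ι (generator b j)) (generator b j) (fromℕ (5 ℕ.+ m)) λ l → ≈-refl
              (ι (generator b j) l))) ,
    λ l → + G b j l , ≈-refl (fromℕℝ (G b j l))

  integral : Vertex P ⊆ ℤ^ (5 ℕ.+ m)
  integral {x} x∈ l =
    let y , y∈ , x≋y      = vertex∈generators {S = Range vertices} x x∈
        b , j , _ , y≋    = Range⇒generator y y∈
    in  + generator b j l , ≈-trans (x l) (y l) (ι (generator b j) l) (x≋y l) (y≋ l)

  -- Lattice points of the cone

  module _ (f g : Form (6 ℕ.+ m)) (le : ∀ b j → j ℕ.≤ h → ⟦ f ⟧ℕ (G b j) ℕ.≤ ⟦ g ⟧ℕ (G b j)) where

    vertices-⊑ : ∀ y → Range vertices y → (f ⊑ g) (atHeightOne y)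
    vertices-⊑ y y∈ = let b , j , j≤h , y≋ = Range⇒generator y y∈ in
      ⊑-resp f g (atHeightOne y) (ι (G b j)) (insertAt-ι y (generator b j) (fromℕ (5 ℕ.+ m)) y≋)
        (⊑-ι f g (G b j) (le b j j≤h))

    P-⊑ : ∀ x → P x → (f ⊑ g) (atHeightOne x)
    P-⊑ = ⊑-hull {S = Range vertices} f g vertices-⊑

    ℝ≥0𝒜-⊑ : ∀ w → ℝ≥0𝒜 P w → (f ⊑ g) w
    ℝ≥0𝒜-⊑ = ⊑-ℝ≥0𝒜 {S = Range vertices} f g vertices-⊑

  sumᵘ totalˣ totalʸ : Form (6 ℕ.+ m)
  sumᵘ   = ∑ (λ i → var (apex i))
  totalˣ = var 1F ⊕ var 2F ⊕ sumᵘ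
  totalʸ = var 3F ⊕ var 4F ⊕ sumᵘ

  module GC (b : Fin (4 ℕ.+ m)) (j : ℕ) (j≤h : j ℕ.≤ h) = Constraints (G-constraints b j j≤h)

  ℝ≥0𝒜-constraints : ∀ V → ℝ≥0𝒜 P (ι V) → Constraints V
  ℝ≥0𝒜-constraints V V∈ = record
    { square = ℕ.≤-antisym
        (bound (var 1F ⊕ var 2F) (var 3F ⊕ var 4F) λ b j j≤h → ℕ.≤-reflexive (GC.square b j j≤h))
        (bound (var 3F ⊕ var 4F) (var 1F ⊕ var 2F) λ b j j≤h → ℕ.≤-reflexive (≡.sym (GC.square b j j≤h)))
    ; total  = ℕ.≤-antisym
        (bound totalˣ (var height) λ b j j≤h → ℕ.≤-reflexive (GC.total b j j≤h))
        (bound (var height) totalˣ λ b j j≤h → ℕ.≤-reflexive (≡.sym (GC.total b j j≤h)))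
    ; lower  = bound (K ⊙ var 1F) (var 0F ⊕ K ⊙ var 4F) GC.lower
    ; upperˣ = bound (var 0F) (K ⊙ var 1F ⊕ h ⊙ var height) GC.upperˣ
    ; upperʸ = bound (var 0F) (K ⊙ var 3F ⊕ h ⊙ var height) GC.upperʸ
    }
    where
    bound : ∀ f g → (∀ b j → j ℕ.≤ h → ⟦ f ⟧ℕ (G b j) ℕ.≤ ⟦ g ⟧ℕ (G b j)) → ⟦ f ⟧ℕ V ℕ.≤ ⟦ g ⟧ℕ V
    bound f g le = ⊑-ι⁻¹ f g V (ℝ≥0𝒜-⊑ f g le (ι V) V∈)

  integer-cone : ∀ w → ℝ≥0𝒜 P w → ℤ^ (6 ℕ.+ m) w → ∃[ V ] w ≋ ι V × Constraints V
  integer-cone w w∈ w∈ℤ =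
    let V , w≋V = nonneg-integer⇒natural w w∈ℤ nonneg
    in  V , w≋V , ℝ≥0𝒜-constraints V (combination-resp {C = Nonnegative} {S = 𝒜 P} (ι V) w
          (≋-sym w (ι V) w≋V) w∈)
    where
    nonneg : ∀ j → 0ℝ ≤ʳ w j
    nonneg j = ≤-resp-≈ (fromℕℝ 0 * w j) 0ℝ (w j) (w j)
      (pointwise-≈ (fromℕℝ 0 * w j) 0ℝ λ k → ℚ.*-zeroˡ (seq (w j) k)) (≈-refl (w j))
      -- Forms have no constants, so `0 ⊙ var j` stands for zero.
      (ℝ≥0𝒜-⊑ (0 ⊙ var j) (var j) (λ _ _ _ → z≤n) w w∈)

  -- The height decides: it is 1 on `𝒜 P` and 2 for a hole, so the second alternative of
  -- `decomposition⊎hole` is impossible. This replaces an enumeration of `𝒜 P`.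
  𝒜⇒decomposition : ∀ y → 𝒜 P y → ∃[ V ] y ≋ ι V × Decomposition V
  𝒜⇒decomposition y y∈@(y∈hom , y∈ℤ) =
    let V , y≋V , C = integer-cone y (𝒜⇒ℝ≥0𝒜 P y y∈) y∈ℤ
        V-height = fromℕ-injective (V height) 1
          (≈-trans (fromℕℝ (V height)) (y height) 1ℝ (≈-sym (y height) (fromℕℝ (V height)) (y≋V height))
            (homogenization-height P y y∈hom))
    in  V , y≋V , [ (λ D → D) , (λ (j , V≗) → contradiction
          (≡.trans (≡.sym V-height) (≡.trans (V≗ height) (insertAt-lookup (λ _ → 0) (fromℕ m) 2))) λ ()) ]′
          (decomposition⊎hole V C)

  ℤ≥0𝒜⇒decomposition : ∀ w → ℤ≥0𝒜 P w → ∃[ V ] w ≋ ι V × Decomposition V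
  ℤ≥0𝒜⇒decomposition = combination-rec {C = Natural} {S = 𝒜 P} (λ w → ∃[ V ] w ≋ ι V × Decomposition V)
    (λ x y x≋y (V , y≋V , D) → V , ≋-trans x y (ι V) x≋y y≋V , D)
    ((λ _ → 0) , (λ j → ≈-refl 0ℝ) , decomposition-0)
    (λ c y x (k , c≈k) y∈ (W , x≋W , E) →
      let V , y≋V , D = 𝒜⇒decomposition y y∈ in
      (λ j → k ℕ.* V j ℕ.+ W j) ,
      (λ j → ≈-trans (c * y j + x j) (fromℕℝ k * fromℕℝ (V j) + fromℕℝ (W j)) (fromℕℝ (k ℕ.* V j ℕ.+ W j))
        (+-cong (c * y j) (fromℕℝ k * fromℕℝ (V j)) (x j) (fromℕℝ (W j))
          (*-cong c (fromℕℝ k) (y j) (fromℕℝ (V j)) c≈k (y≋V j)) (x≋W j))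
        (≈-sym (fromℕℝ (k ℕ.* V j ℕ.+ W j)) (fromℕℝ k * fromℕℝ (V j) + fromℕℝ (W j))
          (≈-trans (fromℕℝ (k ℕ.* V j ℕ.+ W j)) (fromℕℝ (k ℕ.* V j) + fromℕℝ (W j))
            (fromℕℝ k * fromℕℝ (V j) + fromℕℝ (W j))
            (fromℕ-homo-+ (k ℕ.* V j) (W j))
            (+-cong (fromℕℝ (k ℕ.* V j)) (fromℕℝ k * fromℕℝ (V j)) (fromℕℝ (W j)) (fromℕℝ (W j))
              (fromℕ-homo-* k (V j)) (≈-refl (fromℕℝ (W j))))))) ,
      decomposition-∷ k D E)

  -- Decomposable points belong to the semigroup

  InSemigroup : Vector ℕ (6 ℕ.+ m) → Set
  InSemigroup V = ℤ≥0𝒜 P (ι V)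

  semigroup-resp : ∀ {V W} → V ≗ W → InSemigroup V → InSemigroup W
  semigroup-resp {V} {W} V≗W = combination-resp {C = Natural} {S = 𝒜 P} (ι W) (ι V) (ι-cong (≡.sym ∘ V≗W))

  semigroup-+ : ∀ V W → InSemigroup V → InSemigroup W → InSemigroup (λ j → V j ℕ.+ W j)
  semigroup-+ V W V∈ W∈ = combination-resp {C = Natural} {S = 𝒜 P} (ι (λ j → V j ℕ.+ W j))
      (λ j → ι V j + ι W j)
    (λ j → fromℕ-homo-+ (V j) (W j))
    (combination-+ {C = Natural} {S = 𝒜 P} (ι V) (ι W) V∈ W∈)

  -- The whole interval of length hn above V lies in the semigroup. Lengths of intervals add just as
  -- heights do, so the property is inherited by sums.
  Liftable : Vector ℕ (6 ℕ.+ m) → Set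
  Liftable V = ∀ ζ → ζ ℕ.≤ h ℕ.* V height → InSemigroup (raise ζ V)

  liftable-0 : Liftable (λ _ → 0)
  liftable-0 ζ ζ≤ = combination-resp {C = Natural} {S = 𝒜 P} (ι (raise ζ λ _ → 0)) (λ _ → 0ℝ)
    (ι-cong {V = raise ζ λ _ → 0} {W = λ _ → 0} raise≗0)
    (combination-0 {C = Natural} {S = 𝒜 P})
    where
    raise≗0 : raise ζ (λ _ → 0) ≗ λ _ → 0
    raise≗0 zero    = ≡.trans (ℕ.+-identityʳ ζ) (ℕ.n≤0⇒n≡0 (ℕ.≤-trans ζ≤ (ℕ.≤-reflexive (ℕ.*-zeroʳ h))))
    raise≗0 (suc j) = ≡.refl

  liftable-+ : ∀ V W → Liftable V → Liftable W → Liftable (λ j → V j ℕ.+ W j)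
  liftable-+ V W V↑ W↑ ζ ζ≤ = semigroup-resp raise-+
    (semigroup-+ (raise ζ₁ V) (raise ζ₂ W) (V↑ ζ₁ (ℕ.m⊓n≤m (h ℕ.* V height) ζ))
      (W↑ ζ₂ (ℕ.m≤n+o⇒m∸n≤o ζ (h ℕ.* V height)
        (ℕ.≤-trans ζ≤ (ℕ.≤-reflexive (ℕ.*-distribˡ-+ h (V height) (W height)))))))
    where
    -- The first summand is filled to capacity before the rest goes to the second.
    ζ₁ = (h ℕ.* V height) ℕ.⊓ ζ
    ζ₂ = ζ ℕ.∸ h ℕ.* V height

    raise-+ : (λ j → raise ζ₁ V j ℕ.+ raise ζ₂ W j) ≗ raise ζ (λ j → V j ℕ.+ W j)
    raise-+ zero = ≡.trans (CommutativeSemigroup.interchange ℕ.+-commutativeSemigroup ζ₁ (V zero) ζ₂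
        (W zero))
      (cong (ℕ._+ (V zero ℕ.+ W zero)) (ℕ.m⊓n+n∸m≡n (h ℕ.* V height) ζ))
    raise-+ (suc j) = ≡.refl

  liftable-* : ∀ k V → Liftable V → Liftable (λ j → k ℕ.* V j)
  liftable-* zero    V V↑ = liftable-0
  liftable-* (suc k) V V↑ = liftable-+ V (λ j → k ℕ.* V j) V↑ (liftable-* k V V↑)

  liftable-sum : ∀ {r} (V : Fin r → Vector ℕ (6 ℕ.+ m)) → (∀ i → Liftable (V i))
      → Liftable (λ j → ℕΣ.sum (λ i → V i j))
  liftable-sum {zero}  V V↑ = liftable-0
  liftable-sum {suc r} V V↑ = liftable-+ (V zero) (λ j → ℕΣ.sum (λ i → V (suc i) j)) (V↑ zero)
      (liftable-sum (V ∘ suc) (V↑ ∘ suc))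

  liftable-G : ∀ b → Liftable (G b 0)
  liftable-G b ζ ζ≤ = semigroup-resp raise-G
    (generator∈combinations {C = Natural} {S = 𝒜 P} (1 , ≈-refl 1ℝ) (ι (G b ζ))
      (G∈𝒜 b ζ (ℕ.≤-trans ζ≤ (ℕ.≤-reflexive (≡.trans (cong (h ℕ.*_) (G-height b 0)) (ℕ.*-identityʳ h))))))
    where
    raise-G : G b ζ ≗ raise ζ (G b 0)
    raise-G zero = first b
      where
      first : ∀ b → G b ζ zero ≡ ζ ℕ.+ G b 0 zero
      first 0F = ≡.sym (ℕ.+-identityʳ ζ)
      first 1F = ≡.sym (ℕ.+-identityʳ ζ)
      first 2F = ≡.sym (ℕ.+-identityʳ ζ)
      first 3F = ≡.refl
      first (suc (suc (suc (suc i)))) = ≡.sym (ℕ.+-identityʳ ζ)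
    raise-G (suc j) = cong (λ (V : Vector ℕ (4 ℕ.+ m)) → insertAt V (fromℕ (4 ℕ.+ m)) 1 j) (rest b)
      where
      rest : ∀ b → generator b ζ ∘ suc ≡ generator b 0 ∘ suc
      rest 0F = ≡.refl
      rest 1F = ≡.refl
      rest 2F = ≡.refl
      rest 3F = ≡.refl
      rest (suc (suc (suc (suc i)))) = ≡.refl

  decomposition⇒semigroup : ∀ V → Decomposition V → InSemigroup V
  decomposition⇒semigroup V D = semigroup-resp (recombine-decomposition V D)
    (liftable-recombine ζ (ℕ.≤-trans ζ≤ (ℕ.≤-reflexive
        (cong (h ℕ.*_) (≡.sym (recombine-decomposition V D height))))))
    where
    open Decomposition D
    u = V ∘ apex
    liftable-recombine : Liftable (recombine t a b c u)
    liftable-recombine =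
      liftable-+ (λ j → c ℕ.* G 0F 0 j) _ (liftable-* c (G 0F 0) (liftable-G 0F))
        (liftable-+ (λ j → a ℕ.* G 1F 0 j) _ (liftable-* a (G 1F 0) (liftable-G 1F))
          (liftable-+ (λ j → b ℕ.* G 2F 0 j) _ (liftable-* b (G 2F 0) (liftable-G 2F))
            (liftable-+ (λ j → t ℕ.* G 3F 0 j) _ (liftable-* t (G 3F 0) (liftable-G 3F))
              (liftable-sum (λ i j → u i ℕ.* G (suc (suc (suc (suc i)))) 0 j)
                λ i → liftable-* (u i) (G (suc (suc (suc (suc i)))) 0)
                    (liftable-G (suc (suc (suc (suc i)))))))))

  -- Integrality and dimension

  isIntegralConvexPolytope : IsIntegralConvexPolytope P
  isIntegralConvexPolytope =
    ((4 ℕ.+ m) ℕ.* suc h , vertices , (λ {x} (x∈ : P x) → x∈) ,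
        (λ {x} (x∈ : P x) → x∈)) , λ {x} → integral {x}

  -- The corner (0,0) with two points of its segment, then (1,0), (0,1) and the apexes with one
  -- point each. The second point over (0,0) lies on the segment only if its length h is at least 1.
  basis : Fin (4 ℕ.+ m) → Vector ℕ (5 ℕ.+ m)
  basis 0F = generator 0F 0
  basis 1F = generator 0F 1
  basis 2F = generator 1F 0
  basis 3F = generator 2F 0
  basis b@(suc (suc (suc (suc i)))) = generator b 0

  combinationℚ : Vector ℚ (4 ℕ.+ m) → Fin (5 ℕ.+ m) → ℚ
  combinationℚ c j = ℚΣ.sum (λ i → c i ℚ.* (+ basis i j ℚ./ 1))

  module _ (c : Vector ℚ (4 ℕ.+ m)) where
    private
      c₀ = c 0F
      c₁ = c 1F
      c₂ = c 2F
      c₃ = c 3F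
      cᵤ : Vector ℚ m
      cᵤ i = c (suc (suc (suc (suc i))))

    combination-z : combinationℚ c 0F ≡ c₁
    combination-z = ≡.trans (cong (λ s → c₀ ℚ.* 0ℚ ℚ.+ (c₁ ℚ.* 1ℚ ℚ.+ (c₂ ℚ.* 0ℚ ℚ.+ (c₃ ℚ.* 0ℚ ℚ.+ s))))
        (sum-*0ℚ cᵤ))
      (solve 4 (λ a b c d → a :* con 0ℚ :+ (b :* con 1ℚ :+ (c :* con 0ℚ :+ (d :* con 0ℚ :+ con 0ℚ))) := b)
          ≡.refl c₀ c₁ c₂ c₃)

    combination-x : combinationℚ c 1F ≡ c₂
    combination-x = ≡.trans (cong (λ s → c₀ ℚ.* 0ℚ ℚ.+ (c₁ ℚ.* 0ℚ ℚ.+ (c₂ ℚ.* 1ℚ ℚ.+ (c₃ ℚ.* 0ℚ ℚ.+ s))))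
        (sum-*0ℚ cᵤ))
      (solve 4 (λ a b c d → a :* con 0ℚ :+ (b :* con 0ℚ :+ (c :* con 1ℚ :+ (d :* con 0ℚ :+ con 0ℚ))) := c)
          ≡.refl c₀ c₁ c₂ c₃)

    combination-x′ : combinationℚ c 2F ≡ c₀ ℚ.+ c₁ ℚ.+ c₃
    combination-x′ = ≡.trans (cong (λ s → c₀ ℚ.* 1ℚ ℚ.+ (c₁ ℚ.* 1ℚ ℚ.+ (c₂ ℚ.* 0ℚ ℚ.+ (c₃ ℚ.* 1ℚ ℚ.+ s))))
        (sum-*0ℚ cᵤ))
      (solve 4 (λ a b c d → a :* con 1ℚ :+ (b :* con 1ℚ :+ (c :* con 0ℚ :+ (d :* con 1ℚ :+ con 0ℚ)))
          := a :+ b :+ d) ≡.refl c₀ c₁ c₂ c₃)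

    combination-y : combinationℚ c 3F ≡ c₃
    combination-y = ≡.trans (cong (λ s → c₀ ℚ.* 0ℚ ℚ.+ (c₁ ℚ.* 0ℚ ℚ.+ (c₂ ℚ.* 0ℚ ℚ.+ (c₃ ℚ.* 1ℚ ℚ.+ s))))
        (sum-*0ℚ cᵤ))
      (solve 4 (λ a b c d → a :* con 0ℚ :+ (b :* con 0ℚ :+ (c :* con 0ℚ :+ (d :* con 1ℚ :+ con 0ℚ))) := d)
          ≡.refl c₀ c₁ c₂ c₃)

    combination-y′ : combinationℚ c 4F ≡ c₀ ℚ.+ c₁ ℚ.+ c₂
    combination-y′ = ≡.trans (cong (λ s → c₀ ℚ.* 1ℚ ℚ.+ (c₁ ℚ.* 1ℚ ℚ.+ (c₂ ℚ.* 1ℚ ℚ.+ (c₃ ℚ.* 0ℚ ℚ.+ s))))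
        (sum-*0ℚ cᵤ))
      (solve 4 (λ a b c d → a :* con 1ℚ :+ (b :* con 1ℚ :+ (c :* con 1ℚ :+ (d :* con 0ℚ :+ con 0ℚ)))
          := a :+ b :+ c) ≡.refl c₀ c₁ c₂ c₃)

    combination-u : ∀ i → combinationℚ c (suc (suc (suc (suc (suc i))))) ≡ cᵤ i
    combination-u i = ≡.trans (cong (λ s → c₀ ℚ.* 0ℚ ℚ.+
        (c₁ ℚ.* 0ℚ ℚ.+ (c₂ ℚ.* 0ℚ ℚ.+ (c₃ ℚ.* 0ℚ ℚ.+ s)))) (sum-*-unitℚ cᵤ i))
      (solve 5 (λ a b c d u → a :* con 0ℚ :+ (b :* con 0ℚ :+ (c :* con 0ℚ :+ (d :* con 0ℚ :+ u))) := u)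
          ≡.refl c₀ c₁ c₂ c₃ (cᵤ i))

  seq-combination : ∀ (c : Vector ℝ (4 ℕ.+ m)) j k →
    seq (linearCombination c (λ i → ι (basis i)) j) k ≡ combinationℚ (λ i → seq (c i) k) j
  seq-combination c j k = seq-sum (λ i → c i * ι (basis i) j) k

  -- The coordinates z, x, y and u of a combination each isolate one coefficient; the remaining c₀
  -- comes from x′ = c₀ + c₁ + c₃.
  affinelyIndependent : AffinelyIndependent (λ i → ι (basis i))
  affinelyIndependent c ∑c≈0 lc≈0 = independent
    where
    coefficient : ∀ i j → (∀ k → combinationℚ (λ i → seq (c i) k) j ≡ seq (c i) k) → c i ≈ 0ℝ
    coefficient i j eq = ≈-trans (c i) (linearCombination c (λ i → ι (basis i)) j) 0ℝ
      (pointwise-≈ (c i) (linearCombination c (λ i → ι (basis i)) j) λ k →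
        ≡.sym (≡.trans (seq-combination c j k) (eq k)))
      (lc≈0 j)

    c₁≈0 = coefficient 1F 0F λ k → combination-z (λ i → seq (c i) k)
    c₂≈0 = coefficient 2F 1F λ k → combination-x (λ i → seq (c i) k)
    c₃≈0 = coefficient 3F 3F λ k → combination-y (λ i → seq (c i) k)

    c₀≈0 : c 0F ≈ 0ℝ
    c₀≈0 = begin
      c 0F                       ≈⟨ pointwise-≈ (c 0F) (c 0F + 0ℝ + 0ℝ) (λ k →
                                      solve 1 (λ a → a := (a :+ con 0ℚ) :+ con 0ℚ) ≡.refl (seq (c 0F) k)) ⟩
      c 0F + 0ℝ + 0ℝ             ≈⟨ +-cong (c 0F + c 1F) (c 0F + 0ℝ) (c 3F) 0ℝ
                                      (+-cong (c 0F) (c 0F) (c 1F) 0ℝ (≈-refl (c 0F)) c₁≈0) c₃≈0 ⟨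
      c 0F + c 1F + c 3F         ≈⟨ pointwise-≈ (linearCombination c (λ i → ι (basis i)) 2F)
          (c 0F + c 1F + c 3F) (λ k →
                                      ≡.trans (seq-combination c 2F k)
                                          (combination-x′ (λ i → seq (c i) k))) ⟨
      linearCombination c (λ i → ι (basis i)) 2F  ≈⟨ lc≈0 2F ⟩
      0ℝ ∎
      where open SetoidReasoning ≈-setoid

    independent : ∀ i → c i ≈ 0ℝ
    independent 0F = c₀≈0
    independent 1F = c₁≈0
    independent 2F = c₂≈0
    independent 3F = c₃≈0
    independent (suc (suc (suc (suc i)))) =
      coefficient (suc (suc (suc (suc i)))) (suc (suc (suc (suc (suc i))))) λ k → combination-u
          (λ i → seq (c i) k) i

  -- The remaining coordinates x′ and y′ follow from x + x′ + Σ u = 1 = y + y′ + Σ u.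
  spanning : ∀ x → P x → AffineHull (Range λ i → ι (basis i)) x
  spanning x x∈P = 4 ℕ.+ m , c , (λ i → ι (basis i)) , (λ _ → tt) , ∑c≈1 ,
    (λ i → i , λ j → ≈-refl (ι (basis i) j)) , x≋
    where
    xᵤ : Vector ℝ m
    xᵤ i = x (suc (suc (suc (suc (suc i)))))

    c : Vector ℝ (4 ℕ.+ m)
    c 0F = 1ℝ - (x 0F + x 1F + x 3F + sum xᵤ)
    c 1F = x 0F
    c 2F = x 1F
    c 3F = x 3F
    c (suc (suc (suc (suc i)))) = xᵤ i

    ∑c≈1 : sum c ≈ 1ℝ
    ∑c≈1 = pointwise-≈ (sum c) 1ℝ λ k → ≡.trans (seq-sum c k)
      (≡.trans (cong (λ s → seq (c 0F) k ℚ.+ (seq (x 0F) k ℚ.+ (seq (x 1F) k ℚ.+ (seq (x 3F) k ℚ.+ s))))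
          (≡.sym (seq-sum xᵤ k)))
        (solve 4 (λ z x y s → (con 1ℚ :+ con (ℚ.- 1ℚ) :* (z :+ x :+ y :+ s)) :+ (z :+ (x :+ (y :+ s)))
            := con 1ℚ) ≡.refl
          (seq (x 0F) k) (seq (x 1F) k) (seq (x 3F) k) (seq (sum xᵤ) k)))

    total : ∀ p q → (∀ b j → j ℕ.≤ h → G b j (suc p) ℕ.+ G b j (suc q) ℕ.+ ℕΣ.sum (G b j ∘ apex) ≡ 1) →
            atHeightOne x (suc p) + atHeightOne x (suc q) + ⟦ sumᵘ ⟧ (atHeightOne x) ≈ 1ℝ
    total p q eq = ≈-trans (⟦ f ⟧ (atHeightOne x)) (atHeightOne x height) 1ℝ
      (≤-antisym (⟦ f ⟧ (atHeightOne x)) (atHeightOne x height)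
        (P-⊑ f (var height) (λ b j j≤h → ℕ.≤-reflexive (≡.trans (eq b j j≤h) (≡.sym (G-height b j)))) x x∈P)
        (P-⊑ (var height) f (λ b j j≤h → ℕ.≤-reflexive
            (≡.trans (G-height b j) (≡.sym (eq b j j≤h)))) x x∈P))
      (subst (atHeightOne x height ≈_) (insertAt-lookup x (fromℕ (5 ℕ.+ m)) 1ℝ)
          (≈-refl (atHeightOne x height)))
      where f = var (suc p) ⊕ var (suc q) ⊕ sumᵘ

    sumᵘ≈ : ⟦ sumᵘ ⟧ (atHeightOne x) ≈ sum xᵤ
    sumᵘ≈ = sum-cong (λ i → atHeightOne x (apex i)) xᵤ λ i →
      subst (_≈ xᵤ i) (≡.sym (insertAt-inject₁ xᵤ 1ℝ i)) (≈-refl (xᵤ i))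

    totalˣ≈1 : x 1F + x 2F + ⟦ sumᵘ ⟧ (atHeightOne x) ≈ 1ℝ
    totalˣ≈1 = total 0F 1F λ b j j≤h → ≡.trans (GC.total b j j≤h) (G-height b j)

    totalʸ≈1 : x 3F + x 4F + ⟦ sumᵘ ⟧ (atHeightOne x) ≈ 1ℝ
    totalʸ≈1 = total 2F 3F λ b j j≤h →
      ≡.trans (cong (ℕ._+ ℕΣ.sum (G b j ∘ apex)) (≡.sym (GC.square b j j≤h)))
          (≡.trans (GC.total b j j≤h) (G-height b j))

    -- Serves x′ with (p , q , r) = (x , x′ , y) and y′ with (y , y′ , x). The terms z and r are
    -- added and subtracted to match the coefficients of `c`.
    complement : ∀ p q r → p + q + ⟦ sumᵘ ⟧ (atHeightOne x) ≈ 1ℝ →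
      q ≈ 1ℝ - (x 0F + p + r + sum xᵤ) + x 0F + r
    complement p q r total≈1 = begin
      q
        ≈⟨ pointwise-≈ q ((p + q + sum xᵤ) - (p + sum xᵤ)) (λ k →
             solve 3 (λ p q s → q := (p :+ q :+ s) :+ con (ℚ.- 1ℚ) :* (p :+ s))
                 ≡.refl (seq p k) (seq q k) (seq (sum xᵤ) k)) ⟩
      (p + q + sum xᵤ) - (p + sum xᵤ)
        ≈⟨ +-cong (p + q + sum xᵤ) 1ℝ (fromℚ (ℚ.- 1ℚ) * (p + sum xᵤ)) (fromℚ (ℚ.- 1ℚ) * (p + sum xᵤ))
             (≈-trans (p + q + sum xᵤ) (p + q + ⟦ sumᵘ ⟧ (atHeightOne x)) 1ℝ
               (+-cong (p + q) (p + q) (sum xᵤ) (⟦ sumᵘ ⟧ (atHeightOne x)) (≈-refl (p + q))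
                 (≈-sym (⟦ sumᵘ ⟧ (atHeightOne x)) (sum xᵤ) sumᵘ≈))
               total≈1)
             (≈-refl (fromℚ (ℚ.- 1ℚ) * (p + sum xᵤ))) ⟩
      1ℝ - (p + sum xᵤ)
        ≈⟨ pointwise-≈ (1ℝ - (p + sum xᵤ)) (1ℝ - (x 0F + p + r + sum xᵤ) + x 0F + r) (λ k →
             solve 4 (λ z p r s → con 1ℚ :+ con (ℚ.- 1ℚ) :* (p :+ s) :=
               con 1ℚ :+ con (ℚ.- 1ℚ) :* (z :+ p :+ r :+ s) :+ z :+ r) ≡.refl
               (seq (x 0F) k) (seq p k) (seq r k) (seq (sum xᵤ) k)) ⟩
      1ℝ - (x 0F + p + r + sum xᵤ) + x 0F + r ∎
      where open SetoidReasoning ≈-setoid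

    via : ∀ j y → x j ≈ y → (∀ k → combinationℚ (λ i → seq (c i) k) j ≡ seq y k) →
          x j ≈ linearCombination c (λ i → ι (basis i)) j
    via j y x≈y eq = ≈-trans (x j) y (linearCombination c (λ i → ι (basis i)) j) x≈y
      (pointwise-≈ y (linearCombination c (λ i → ι (basis i)) j) λ k →
        ≡.sym (≡.trans (seq-combination c j k) (eq k)))

    x≋ : x ≋ linearCombination c (λ i → ι (basis i))
    x≋ 0F = via 0F (x 0F) (≈-refl (x 0F)) λ k → combination-z (λ i → seq (c i) k)
    x≋ 1F = via 1F (x 1F) (≈-refl (x 1F)) λ k → combination-x (λ i → seq (c i) k)
    x≋ 2F = via 2F (1ℝ - (x 0F + x 1F + x 3F + sum xᵤ) + x 0F + x 3F)
        (complement (x 1F) (x 2F) (x 3F) totalˣ≈1)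
      λ k → combination-x′ (λ i → seq (c i) k)
    x≋ 3F = via 3F (x 3F) (≈-refl (x 3F)) λ k → combination-y (λ i → seq (c i) k)
    x≋ 4F = via 4F (1ℝ - (x 0F + x 1F + x 3F + sum xᵤ) + x 0F + x 1F)
      (≈-trans (x 4F) (1ℝ - (x 0F + x 3F + x 1F + sum xᵤ) + x 0F + x 1F)
          (1ℝ - (x 0F + x 1F + x 3F + sum xᵤ) + x 0F + x 1F)
        (complement (x 3F) (x 4F) (x 1F) totalʸ≈1)
        (pointwise-≈ (1ℝ - (x 0F + x 3F + x 1F + sum xᵤ) + x 0F + x 1F)
            (1ℝ - (x 0F + x 1F + x 3F + sum xᵤ) + x 0F + x 1F) λ k →
          solve 4 (λ z x y s → con 1ℚ :+ con (ℚ.- 1ℚ) :* (z :+ y :+ x :+ s) :+ z :+ x :=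
            con 1ℚ :+ con (ℚ.- 1ℚ) :* (z :+ x :+ y :+ s) :+ z :+ x) ≡.refl
            (seq (x 0F) k) (seq (x 1F) k) (seq (x 3F) k) (seq (sum xᵤ) k)))
      λ k → combination-y′ (λ i → seq (c i) k)
    x≋ (suc (suc (suc (suc (suc i))))) =
      via (suc (suc (suc (suc (suc i))))) (xᵤ i) (≈-refl (xᵤ i)) λ k → combination-u (λ i → seq (c i) k) i

  basis∈P : 1 ≤ h → ∀ b → P (ι (basis b))
  basis∈P 1≤h 0F = generator∈P 0F 0 z≤n
  basis∈P 1≤h 1F = generator∈P 0F 1 1≤h
  basis∈P 1≤h 2F = generator∈P 1F 0 z≤n
  basis∈P 1≤h 3F = generator∈P 2F 0 z≤n
  basis∈P 1≤h b@(suc (suc (suc (suc i)))) = generator∈P b 0 z≤n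

  dimension : 1 ≤ h → HasDimension P (3 ℕ.+ m)
  dimension 1≤h = (λ i → ι (basis i)) , basis∈P 1≤h , affinelyIndependent , λ {x} → spanning x

  -- The holes

  hole∈ℝ≥0𝒜 : ∀ j → ℝ≥0𝒜 P (ι (hole j))
  hole∈ℝ≥0𝒜 j = combination-resp {C = Nonnegative} {S = 𝒜 P} (ι (hole j))
      (λ l → fromℚ ½ * ι (λ l → 2 ℕ.* hole j l) l)
    (λ l → ≈-trans (ι (hole j) l) (fromℚ ½ * (fromℕℝ 2 * ι (hole j) l)) (fromℚ ½ * fromℕℝ (2 ℕ.* hole j l))
      (pointwise-≈ (ι (hole j) l) (fromℚ ½ * (fromℕℝ 2 * ι (hole j) l)) λ k → ≡.sym
          (½*2*p≡p (+ hole j l ℚ./ 1)))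
      (*-congˡ (fromℚ ½) (fromℕℝ 2 * ι (hole j) l) (fromℕℝ (2 ℕ.* hole j l))
        (≈-sym (fromℕℝ (2 ℕ.* hole j l)) (fromℕℝ 2 * ι (hole j) l) (fromℕ-homo-* 2 (hole j l)))))
    (combination-scale {C = Nonnegative} {S = 𝒜 P} (fromℚ ½)
      (λ c → *-nonneg (fromℚ ½) c (pointwise-≤ 0ℝ (fromℚ ½) λ _ → ℚ.<⇒≤ (ℚ.positive⁻¹ ½)))
      (ι (λ l → 2 ℕ.* hole j l))
      (combination-mono {C = Natural} {D = Nonnegative} {S = 𝒜 P} natural⇒nonneg (ι (λ l → 2 ℕ.* hole j l))
        (decomposition⇒semigroup (λ l → 2 ℕ.* hole j l) (decomposition-2hole j))))

  hole∈ℤ𝒜 : ∀ j → ℤ𝒜 P (ι (hole j))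
  hole∈ℤ𝒜 j = combination-resp {C = Integer} {S = 𝒜 P} (ι (hole j))
    (λ l → fromℤ ℤ.-1ℤ * ι (G 0F 0) l + ι (λ l → hole j l ℕ.+ G 0F 0 l) l)
    (λ l → ≈-trans (ι (hole j) l) (fromℤ ℤ.-1ℤ * ι (G 0F 0) l + (ι (hole j) l + ι (G 0F 0) l))
        (fromℤ ℤ.-1ℤ * ι (G 0F 0) l + fromℕℝ (hole j l ℕ.+ G 0F 0 l))
      (pointwise-≈ (ι (hole j) l) (fromℤ ℤ.-1ℤ * ι (G 0F 0) l + (ι (hole j) l + ι (G 0F 0) l)) λ k →
        solve 2 (λ p q → p := con (ℤ.-1ℤ ℚ./ 1) :* q :+ (p :+ q))
            ≡.refl (+ hole j l ℚ./ 1) (+ G 0F 0 l ℚ./ 1))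
      (+-cong (fromℤ ℤ.-1ℤ * ι (G 0F 0) l) (fromℤ ℤ.-1ℤ * ι (G 0F 0) l)
        (ι (hole j) l + ι (G 0F 0) l) (fromℕℝ (hole j l ℕ.+ G 0F 0 l)) (≈-refl (fromℤ ℤ.-1ℤ * ι (G 0F 0) l))
        (≈-sym (fromℕℝ (hole j l ℕ.+ G 0F 0 l)) (ι (hole j) l + ι (G 0F 0) l)
            (fromℕ-homo-+ (hole j l) (G 0F 0 l)))))
    (combination-∷ {C = Integer} {S = 𝒜 P} (fromℤ ℤ.-1ℤ) (ι (G 0F 0)) (ι (λ l → hole j l ℕ.+ G 0F 0 l))
      (ℤ.-1ℤ , ≈-refl (fromℤ ℤ.-1ℤ)) (G∈𝒜 0F 0 z≤n)
      (combination-mono {C = Natural} {D = Integer} {S = 𝒜 P} natural⇒integer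
          (ι (λ l → hole j l ℕ.+ G 0F 0 l))
        (decomposition⇒semigroup (λ l → hole j l ℕ.+ G 0F 0 l) (decomposition-hole+G j))))

  hole∉ℤ≥0𝒜 : ∀ j → ¬ ℤ≥0𝒜 P (ι (hole j))
  hole∉ℤ≥0𝒜 j hole∈ =
    let V , hole≋V , D = ℤ≥0𝒜⇒decomposition (ι (hole j)) hole∈ in
    ¬decomposition-hole j
      (decomposition-resp (λ l → ≡.sym (fromℕ-injective (hole j l) (V l) (hole≋V l))) D)

  hole∈Holes : ∀ j → Holes P (ι (hole j))
  hole∈Holes j = (hole∈ℝ≥0𝒜 j , hole∈ℤ𝒜 j) , hole∉ℤ≥0𝒜 j

  -- Membership in `ℤ𝒜 P` makes the coordinates integers and the cone makes them nonnegative, so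
  -- `decomposition⊎hole` applies; a decomposition would put w into the semigroup.
  Holes⇒hole : ∀ w → Holes P w → ∃[ j ] w ≋ ι (hole j)
  Holes⇒hole w ((w∈ℝ , w∈ℤ) , w∉) =
    let V , w≋V , C = integer-cone w w∈ℝ (ℤ𝒜⇒integer P w w∈ℤ) in
    [ (λ D → contradiction
        (combination-resp {C = Natural} {S = 𝒜 P} w (ι V) w≋V (decomposition⇒semigroup V D)) w∉)
    , (λ (j , V≗hole) → j , ≋-trans w (ι V) (ι (hole j)) w≋V (ι-cong V≗hole)) ]′
    (decomposition⊎hole V C)

  holes-cardinality : HasCardinality (Holes P) h
  holes-cardinality = record
    { to        = λ j → ι (hole j) , hole∈Holes j
    ; cong      = λ { {j} ≡.refl l → ≈-refl (ι (hole j) l) }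
    ; bijective =
        (λ {i} {j} eq → Fin.toℕ-injective (ℕ.+-cancelˡ-≡ (suc (2 ℕ.* h)) (toℕ i) (toℕ j)
          (fromℕ-injective (hole i 0F) (hole j 0F) (eq 0F)))) ,
        λ (w , w∈) → let j , w≋ = Holes⇒hole w w∈ in
          j , λ { ≡.refl → ≋-sym w (ι (hole j)) w≋ }
    }

  ¬normal : 1 ≤ h → ¬ Normal P
  ¬normal 1≤h (⊆ℤ≥0𝒜 , _) = hole∉ℤ≥0𝒜 j (⊆ℤ≥0𝒜 {ι (hole j)} (hole∈ℝ≥0𝒜 j , hole∈ℤ𝒜 j))
    where j = fromℕ< 1≤h

theorem0p1 : ∀ (h d : ℕ) → 1 ≤ h → 3 ≤ d →
    ∃[ N ] Σ[ P ∈ Subset N ]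
    (IsIntegralConvexPolytope P × HasDimension P d ×
    VeryAmple P × ¬ Normal P × HasCardinality (Holes P) h)
theorem0p1 h (suc (suc (suc m))) 1≤h (s≤s (s≤s (s≤s z≤n))) =
  5 ℕ.+ m , Polytope.P h m , Polytope.isIntegralConvexPolytope h m , Polytope.dimension h m 1≤h ,
  (h , Polytope.holes-cardinality h m) , Polytope.¬normal h m 1≤h , Polytope.holes-cardinality h m
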